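{- Let $p$ be a prime with $p\equiv1\pmod4$, and write $p=c^2+d^2$ with $c,d\in\mathbb Z$ and $2\mid d$. Let $a\in\mathbb Z$ with $p\nmid(1+16a^2)(1-16a^2)$. Then $$2\sum_{k=0}^{[p/8]}\binom{8k}{4k}a^{4k}\equiv\begin{cases}\big(\frac{1-4a}p\big)+\big(\frac{c-4ad}{16a^2+1}\big)\pmod p&\text{if }\big(\frac{1-16a^2}p\big)=\big(\frac{1+16a^2}p\big)=1,\\ \big(\frac{1-4a}p\big)\pmod p&\text{if }\big(\frac{1-16a^2}p\big)=-\big(\frac{1+16a^2}p\big)=1,\\ \big(\frac{c-4ad}{16a^2+1}\big)\pmod p&\text{if }\big(\frac{1-16a^2}p\big)=-\big(\frac{1+16a^2}p\big)=-1,\\ 0\pmod p&\text{if }\big(\frac{1-16a^2}p\big)=\big(\frac{1+16a^2}p\big)=-1.\end{cases}$$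
   Context: $[x]$ is the greatest integer not exceeding $x$; $\big(\frac{\cdot}{p}\big)$ is the Legendre symbol and $\big(\frac{x}{16a^2+1}\big)$ the Jacobi symbol. -}

module Defs where

open import Data.Nat as ℕ using (ℕ; zero; suc; _∸_)
open import Data.Nat.Divisibility as ℕD using ()
open import Data.Integer using (ℤ; +_; -_; _-_; _*_; _+_; 0ℤ; 1ℤ; ∣_∣)
open import Data.List using (List; upTo)
open import Data.List.Relation.Unary.Any using (Any; any?)
open import Relation.Nullary.Decidable using (yes; no; Dec)
open import Data.Nat.Combinatorics using (_C_)

IsSquareMod : ℤ → ℕ → Set
IsSquareMod x p = Any (λ y → p ℕD.∣ ∣ (+ y) * (+ y) - x ∣) (upTo p)

isSquareMod? : (x : ℤ) (p : ℕ) → Dec (IsSquareMod x p)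
isSquareMod? x p = any? (λ y → p ℕD.∣? ∣ (+ y) * (+ y) - x ∣) (upTo p)

legendre : ℤ → ℕ → ℤ
legendre x p with p ℕD.∣? ∣ x ∣
... | yes _ = 0ℤ
... | no _ with isSquareMod? x p
...   | yes _ = 1ℤ
...   | no _ = - 1ℤ

-- smallest divisor ≥ 2 of m, written as 2 + spfOff m  (for m ≥ 2 this is
-- the smallest prime factor of m)
private
  search : ℕ → ℕ → ℕ → ℕ
  search zero j m = m ∸ 2
  search (suc f) j m with suc (suc j) ℕD.∣? m
  ... | yes _ = j
  ... | no _ = search f (suc j) m

spfOff : ℕ → ℕ
spfOff m = search m 0 m

-- Jacobi symbol (x / m) for odd m ≥ 1: product of Legendre symbols over the
-- prime factorization of m (with multiplicity), computed by repeatedly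
-- splitting off the smallest prime factor; fuel m suffices.
private
  jacobiF : ℕ → ℤ → ℕ → ℤ
  jacobiF zero x m = 1ℤ
  jacobiF (suc f) x zero = 1ℤ
  jacobiF (suc f) x (suc zero) = 1ℤ
  jacobiF (suc f) x m@(suc (suc _)) =
    legendre x (suc (suc (spfOff m))) * jacobiF f x (m ℕ./ suc (suc (spfOff m)))

jacobi : ℤ → ℕ → ℤ
jacobi x m = jacobiF m x m

sumTo : ℕ → (ℕ → ℤ) → ℤ
sumTo zero f = f 0
sumTo (suc n) f = sumTo n f + f (suc n)

S : ℕ → ℤ → ℤ
S p a = sumTo (p ℕ./ 8) (λ k → (+ ((8 ℕ.* k) C (4 ℕ.* k))) * (a Data.Integer.^ (4 ℕ.* k)))

{-# OPTIONS --safe #-}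

-- Write p = 2h + 1 and y = -4a. Modulo p we have C(2n, n) = (-4)^n C(h, n) for n ≤ h, so the sum is
-- the part of (1 + y)^h of degree divisible by 4, that is, a quarter of
-- (1 + y)^h + (1 - y)^h + (1 + iy)^h + (1 - iy)^h with i = d / c a square root of -1 modulo p.
-- By Euler's criterion these are Legendre symbols; within each pair the product is the symbol of
-- 1 ∓ 16a², so the two terms are equal or opposite. It remains to identify the symbol of
-- 1 + iy = (c - 4ad) / c. If a prime q divides e = c - 4ad, then p = d²(16a² + 1) modulo q, and
-- every prime l dividing 16a² + 1 is 1 modulo 4, so quadratic reciprocity gives
-- (e/p) = ∏ (p/q) = ∏ (16a² + 1 / q) = ∏∏ (l/q) = ∏∏ (q/l) = (e / 16a² + 1);
-- the case a = 0 says (c/p) = 1. Reciprocity between p ≡ 1 mod 4 and q is Gauss's third proof.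
module Submission where

open import Defs
open import Data.Empty using (⊥; ⊥-elim)
open import Data.Fin as Fin using (Fin; toℕ; fromℕ<)
import Data.Fin.Properties as FinP
open import Data.Integer using (ℤ; +_; -[1+_]; -_; _-_; _*_; _+_; _^_; 0ℤ; 1ℤ; -1ℤ; ∣_∣; _%ℕ_; _/ℕ_)
import Data.Integer.DivMod as ℤD
open import Data.Integer.Divisibility using (_∣_)
import Data.Integer.Divisibility.Signed as Signed
import Data.Integer.Properties as ℤP
open import Data.Integer.Tactic.RingSolver using (solve-∀)
open import Data.List using (List; []; _∷_; foldr)
open import Data.List.Membership.Propositional using (lose)
open import Data.List.Membership.Propositional.Properties using (∈-upTo⁺)
open import Data.List.Relation.Unary.All using (All; []; _∷_)
open import Data.List.Relation.Unary.Any using (satisfied)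
open import Data.Nat as ℕ using (ℕ; zero; suc)
open import Data.Nat.Combinatorics using (_C_; nCk+nC[k+1]≡[n+1]C[k+1]; nC1≡n; k>n⇒nCk≡0)
import Data.Nat.DivMod as ℕDM
import Data.Nat.Divisibility as ℕD
open import Data.Nat.ListAction using (product)
open import Data.Nat.Primality using (Prime; _Rough_; euclidsLemma; ¬prime[1]; prime⇒irreducible; prime⇒nonZero; prime⇒nonTrivial; 2-rough; rough⇒≤; ∤⇒rough-suc; rough∧∣⇒prime)
open import Data.Nat.Primality.Factorisation using (factorise; PrimeFactorisation)
import Data.Nat.Properties as ℕP
import Data.Nat.Tactic.RingSolver as ℕRing
open import Data.Product using (_×_; _,_; ∃; proj₁; proj₂)
open import Data.Sum as Sum using (_⊎_; inj₁; inj₂)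
open import Function using (_∘_)
open import Function.Bundles using (mk⤖)
open import Function.Properties.Bijection using (⤖⇒↔)
open import Relation.Binary.Bundles using (Setoid)
open import Relation.Binary.Definitions using (tri<; tri≈; tri>)
open import Relation.Binary.PropositionalEquality using (_≡_; _≢_; refl; sym; trans; cong; cong₂; subst; module ≡-Reasoning)
import Relation.Binary.Reasoning.Setoid as SetoidReasoning
open import Relation.Nullary using (¬_; Dec; yes; no; contradiction)
open import Relation.Nullary.Decidable using (_×-dec_)
open import Algebra.Properties.CommutativeMonoid.Sum ℤP.*-1-commutativeMonoid using () renaming (sum to prod; sum-cong-≗ to prod-cong; ∑-distrib-+ to prod-distrib-*; ∑-comm to prod-comm; sum-permute to prod-permute)

-- Congruences

-- One of the two primes in every use of reciprocity is p or a divisor l of 16a² + 1, hence 1 modulo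
-- 4, so the sign of the law never appears and only this half of it is proved. For the same moduli
-- -1 is a square, so the sign of e is invisible and it is enough to factor |e|. As d is even, e is
-- odd, and the symbol of 2 does not occur either. Euler's criterion is reached without primitive
-- roots. Gauss's lemma shows that a^h is a sign, and bounding the number of roots of X^h - 1 shows
-- that this sign is -1 at nonsquares. From then on every identity between symbols is an identity
-- between h-th powers. The counts in Gauss's third proof are kept as products of signs over a
-- rectangle. Exchanging and reflecting the indices of a double product then replaces any argument
-- about the parity of a cardinality.

infix 4 _≅_[_]

-- A record rather than a synonym, so that unification can recover both sides from the type. Signed
-- divisibility supplies an integer quotient for the ring solver.
record _≅_[_] (x y : ℤ) (n : ℕ) : Set where
  constructor congruent
  field n∣x-y : + n Signed.∣ x - y

open _≅_[_]

≅-witness : ∀ {n x y} k → x ≡ y + k * + n → x ≅ y [ n ]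
≅-witness {n} {y = y} k refl = congruent (Signed.divides k (lemma y (k * + n)))
  where
  lemma : ∀ y z → y + z - y ≡ z
  lemma = solve-∀

≅-quotient : ∀ {n x y} → x ≅ y [ n ] → ∃ λ k → x ≡ y + k * + n
≅-quotient {n} {x} {y} (congruent (Signed.divides k eq)) =
  k , trans (lemma x y) (cong (λ z → y + z) eq)
  where
  lemma : ∀ x y → x ≡ y + (x - y)
  lemma = solve-∀

≡⇒≅ : ∀ {n x y} → x ≡ y → x ≅ y [ n ]
≡⇒≅ {n} {x} refl = ≅-witness 0ℤ (sym (ℤP.+-identityʳ x))

≅-refl : ∀ {n x} → x ≅ x [ n ]
≅-refl = ≡⇒≅ refl

≅-sym : ∀ {n x y} → x ≅ y [ n ] → y ≅ x [ n ]
≅-sym {n} {x} {y} x≅y =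
  let k , eq = ≅-quotient x≅y
  in ≅-witness (- k) (trans (lemma y k (+ n)) (cong (_+ (- k) * + n) (sym eq)))
  where
  lemma : ∀ y k n → y ≡ y + k * n + (- k) * n
  lemma = solve-∀

≅-trans : ∀ {n x y z} → x ≅ y [ n ] → y ≅ z [ n ] → x ≅ z [ n ]
≅-trans {n} {z = z} x≅y y≅z =
  let j , eq₁ = ≅-quotient x≅y
      k , eq₂ = ≅-quotient y≅z
  in ≅-witness (k + j) (trans eq₁ (trans (cong (_+ j * + n) eq₂) (lemma z k j (+ n))))
  where
  lemma : ∀ z k j n → z + k * n + j * n ≡ z + (k + j) * n
  lemma = solve-∀

≅-setoid : ℕ → Setoid _ _
≅-setoid n = record
  { Carrier = ℤ
  ; _≈_ = _≅_[ n ]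
  ; isEquivalence = record { refl = ≅-refl ; sym = ≅-sym ; trans = ≅-trans }
  }

+-cong : ∀ {n x y u v} → x ≅ y [ n ] → u ≅ v [ n ] → x + u ≅ y + v [ n ]
+-cong {n} {y = y} {v = v} x≅y u≅v =
  let j , eq₁ = ≅-quotient x≅y
      k , eq₂ = ≅-quotient u≅v
  in ≅-witness (j + k) (trans (cong₂ _+_ eq₁ eq₂) (lemma y v j k (+ n)))
  where
  lemma : ∀ y v j k n → y + j * n + (v + k * n) ≡ y + v + (j + k) * n
  lemma = solve-∀

*-cong : ∀ {n x y u v} → x ≅ y [ n ] → u ≅ v [ n ] → x * u ≅ y * v [ n ]
*-cong {n} {y = y} {v = v} x≅y u≅v =
  let j , eq₁ = ≅-quotient x≅y
      k , eq₂ = ≅-quotient u≅v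
  in ≅-witness (y * k + j * v + j * k * + n) (trans (cong₂ _*_ eq₁ eq₂) (lemma y v j k (+ n)))
  where
  lemma : ∀ y v j k n → (y + j * n) * (v + k * n) ≡ y * v + (y * k + j * v + j * k * n) * n
  lemma = solve-∀

*-congˡ : ∀ {n x y} z → x ≅ y [ n ] → z * x ≅ z * y [ n ]
*-congˡ z = *-cong (≅-refl {x = z})

*-congʳ : ∀ {n x y} z → x ≅ y [ n ] → x * z ≅ y * z [ n ]
*-congʳ z x≅y = *-cong x≅y (≅-refl {x = z})

-‿cong : ∀ {n x y} → x ≅ y [ n ] → - x ≅ - y [ n ]
-‿cong {n} {x} {y} x≅y =
  let k , eq = ≅-quotient x≅y
  in ≅-witness (- k) (trans (cong -_ eq) (lemma y k (+ n)))
  where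
  lemma : ∀ y k n → - (y + k * n) ≡ - y + (- k) * n
  lemma = solve-∀

^-cong : ∀ {n x y} k → x ≅ y [ n ] → x ^ k ≅ y ^ k [ n ]
^-cong zero x≅y = ≅-refl
^-cong (suc k) x≅y = *-cong x≅y (^-cong k x≅y)

≅0⇒∣ : ∀ {n x} → x ≅ 0ℤ [ n ] → n ℕD.∣ ∣ x ∣
≅0⇒∣ {n} {x} (congruent d) = Signed.∣⇒∣ᵤ (subst (+ n Signed.∣_) (ℤP.+-identityʳ x) d)

∣⇒≅0 : ∀ {n x} → n ℕD.∣ ∣ x ∣ → x ≅ 0ℤ [ n ]
∣⇒≅0 {n} {x} d = congruent (subst (+ n Signed.∣_) (sym (ℤP.+-identityʳ x)) (Signed.∣ᵤ⇒∣ d))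

≅⇒∣ : ∀ {n x y} → x ≅ y [ n ] → n ℕD.∣ ∣ x - y ∣
≅⇒∣ (congruent d) = Signed.∣⇒∣ᵤ d

∣⇒≅ : ∀ {n x y} → n ℕD.∣ ∣ x - y ∣ → x ≅ y [ n ]
∣⇒≅ d = congruent (Signed.∣ᵤ⇒∣ d)

≅⇒-≅0 : ∀ {n x y} → x ≅ y [ n ] → x - y ≅ 0ℤ [ n ]
≅⇒-≅0 = ∣⇒≅0 ∘ ≅⇒∣

-≅0⇒≅ : ∀ {n x y} → x - y ≅ 0ℤ [ n ] → x ≅ y [ n ]
-≅0⇒≅ = ∣⇒≅ ∘ ≅0⇒∣

small≇0 : ∀ {n k} → k ≢ 0 → k ℕ.< n → ¬ + k ≅ 0ℤ [ n ]
small≇0 {k = zero} k≢0 _ _ = k≢0 refl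
small≇0 {k = suc k} _ k<n k≅0 = ℕP.<⇒≱ k<n (ℕD.∣⇒≤ (≅0⇒∣ k≅0))

*≅0 : ∀ {p} → Prime p → ∀ x y → x * y ≅ 0ℤ [ p ] → x ≅ 0ℤ [ p ] ⊎ y ≅ 0ℤ [ p ]
*≅0 {p} pp x y xy≅0 =
  Sum.map ∣⇒≅0 ∣⇒≅0 (euclidsLemma ∣ x ∣ ∣ y ∣ pp (subst (p ℕD.∣_) (ℤP.abs-* x y) (≅0⇒∣ xy≅0)))

*-cancelˡ : ∀ {p} → Prime p → ∀ x {y z} → ¬ x ≅ 0ℤ [ p ] → x * y ≅ x * z [ p ] → y ≅ z [ p ]
*-cancelˡ pp x {y} {z} x≇0 xy≅xz =
  Sum.[ (λ x≅0 → contradiction x≅0 x≇0) , -≅0⇒≅ ]′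
    (*≅0 pp x (y - z) (≅-trans (≡⇒≅ (lemma x y z)) (≅⇒-≅0 xy≅xz)))
  where
  lemma : ∀ x y z → x * (y - z) ≡ x * y - x * z
  lemma = solve-∀

*-≇0 : ∀ {p} → Prime p → ∀ {x y} → ¬ x ≅ 0ℤ [ p ] → ¬ y ≅ 0ℤ [ p ] → ¬ x * y ≅ 0ℤ [ p ]
*-≇0 pp {x} {y} x≇0 y≇0 xy≅0 = Sum.[ x≇0 , y≇0 ]′ (*≅0 pp x y xy≅0)

*-^-distrib : ∀ x y n → (x * y) ^ n ≡ x ^ n * y ^ n
*-^-distrib x y zero = refl
*-^-distrib x y (suc n) = trans (cong (x * y *_) (*-^-distrib x y n)) (lemma x y (x ^ n) (y ^ n))
  where
  lemma : ∀ x y u v → x * y * (u * v) ≡ x * u * (y * v)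
  lemma = solve-∀

-- Finite products

∏ : ℕ → (ℕ → ℤ) → ℤ
∏ n f = prod {n} (f ∘ toℕ)

∏-cong : ∀ n {f g} → (∀ k → k ℕ.< n → f k ≡ g k) → ∏ n f ≡ ∏ n g
∏-cong n f≡g = prod-cong (λ i → f≡g (toℕ i) (FinP.toℕ<n i))

∏-cong-≅ : ∀ {m} n {f g} → (∀ k → k ℕ.< n → f k ≅ g k [ m ]) → ∏ n f ≅ ∏ n g [ m ]
∏-cong-≅ zero _ = ≅-refl
∏-cong-≅ (suc n) f≅g = *-cong (f≅g 0 (ℕ.s≤s ℕ.z≤n)) (∏-cong-≅ n (λ k k<n → f≅g (suc k) (ℕ.s≤s k<n)))

∏-distrib-* : ∀ n f g → ∏ n (λ k → f k * g k) ≡ ∏ n f * ∏ n g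
∏-distrib-* n f g = prod-distrib-* (f ∘ toℕ {n}) (g ∘ toℕ)

∏-comm : ∀ m n (f : ℕ → ℕ → ℤ) → ∏ m (λ i → ∏ n (f i)) ≡ ∏ n (λ j → ∏ m (λ i → f i j))
∏-comm m n f = prod-comm {m} {n} (λ i j → f (toℕ i) (toℕ j))

∏-const : ∀ n x → ∏ n (λ _ → x) ≡ x ^ n
∏-const zero x = refl
∏-const (suc n) x = cong (x *_) (∏-const n x)

∏-one : ∀ n f → (∀ k → k ℕ.< n → f k ≡ 1ℤ) → ∏ n f ≡ 1ℤ
∏-one n f f≡1 = trans (∏-cong n f≡1) (trans (∏-const n 1ℤ) (ℤP.^-zeroˡ n))

∏-single : ∀ n f j → j ℕ.< n → (∀ k → k ℕ.< n → k ≢ j → f k ≡ 1ℤ) → ∏ n f ≡ f j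
∏-single (suc n) f zero _ f≡1 =
  trans (cong (f 0 *_) (∏-one n (f ∘ suc) (λ k k<n → f≡1 (suc k) (ℕ.s≤s k<n) (λ ())))) (ℤP.*-identityʳ (f 0))
∏-single (suc n) f (suc j) (ℕ.s≤s j<n) f≡1 =
  trans (cong₂ _*_ (f≡1 0 (ℕ.s≤s ℕ.z≤n) (λ ()))
                   (∏-single n (f ∘ suc) j j<n (λ k k<n k≢j → f≡1 (suc k) (ℕ.s≤s k<n) (k≢j ∘ ℕP.suc-injective))))
        (ℤP.*-identityˡ (f (suc j)))

∏-split : ∀ m n f → ∏ (m ℕ.+ n) f ≡ ∏ m f * ∏ n (λ k → f (m ℕ.+ k))
∏-split zero n f = sym (ℤP.*-identityˡ _)
∏-split (suc m) n f = trans (cong (f 0 *_) (∏-split m n (f ∘ suc))) (sym (ℤP.*-assoc (f 0) _ _))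

∏-last : ∀ n f → ∏ (suc n) f ≡ ∏ n f * f n
∏-last zero f = ℤP.*-comm (f 0) 1ℤ
∏-last (suc n) f = trans (cong (f 0 *_) (∏-last n (f ∘ suc))) (sym (ℤP.*-assoc (f 0) _ _))

∏-reverse : ∀ n f → ∏ n f ≡ ∏ n (λ k → f (n ℕ.∸ suc k))
∏-reverse zero f = refl
∏-reverse (suc n) f = begin
  ∏ (suc n) f                           ≡⟨ ∏-last n f ⟩
  ∏ n f * f n                           ≡⟨ cong (_* f n) (∏-reverse n f) ⟩
  ∏ n (λ k → f (n ℕ.∸ suc k)) * f n     ≡⟨ ℤP.*-comm _ (f n) ⟩
  f n * ∏ n (λ k → f (n ℕ.∸ suc k))     ∎
  where open ≡-Reasoning

∏-≇0 : ∀ {p} → Prime p → ∀ n f → (∀ k → k ℕ.< n → ¬ f k ≅ 0ℤ [ p ]) → ¬ ∏ n f ≅ 0ℤ [ p ]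
∏-≇0 pp zero f _ 1≅0 = ¬prime[1] (subst Prime (ℕD.∣1⇒≡1 (≅0⇒∣ 1≅0)) pp)
∏-≇0 pp (suc n) f f≇0 =
  *-≇0 pp (f≇0 0 (ℕ.s≤s ℕ.z≤n)) (∏-≇0 pp n (f ∘ suc) (λ k k<n → f≇0 (suc k) (ℕ.s≤s k<n)))

-- Pigeonhole: punching out a missed value would inject a set of size n + 1 into one of size n.
injective⇒surjective : ∀ {n} (f : Fin n → Fin n) → (∀ {i j} → f i ≡ f j → i ≡ j) → ∀ y → ∃ λ x → f x ≡ y
injective⇒surjective {suc n} f inj y with FinP.any? (λ x → f x FinP.≟ y)
... | yes found = found
... | no none = contradiction
  (FinP.injective⇒≤ {f = λ x → Fin.punchOut (λ y≡fx → none (x , sym y≡fx))}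
    (λ {i} {j} eq → inj (FinP.punchOut-injective (λ e → none (i , sym e)) (λ e → none (j , sym e)) eq)))
  ℕP.1+n≰n

∏-rearrange : ∀ n (f : ℕ → ℤ) (σ : ℕ → ℕ) → (∀ k → k ℕ.< n → σ k ℕ.< n) →
  (∀ i j → i ℕ.< n → j ℕ.< n → σ i ≡ σ j → i ≡ j) → ∏ n (f ∘ σ) ≡ ∏ n f
∏-rearrange n f σ σ< σ-inj = begin
  ∏ n (f ∘ σ)         ≡⟨ prod-cong {x = f ∘ σ ∘ toℕ} {y = f ∘ toℕ ∘ τ} (λ i → cong f (sym (FinP.toℕ-fromℕ< _))) ⟩
  prod (f ∘ toℕ ∘ τ)  ≡⟨ prod-permute (f ∘ toℕ) (⤖⇒↔ (mk⤖ (τ-inj , λ y → let x , τx≡y = injective⇒surjective τ τ-inj y in x , λ { refl → τx≡y }))) ⟨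
  ∏ n f               ∎
  where
  open ≡-Reasoning
  τ : Fin n → Fin n
  τ i = fromℕ< (σ< (toℕ i) (FinP.toℕ<n i))
  τ-inj : ∀ {i j} → τ i ≡ τ j → i ≡ j
  τ-inj {i} {j} eq = FinP.toℕ-injective (σ-inj (toℕ i) (toℕ j) (FinP.toℕ<n i) (FinP.toℕ<n j)
    (trans (sym (FinP.toℕ-fromℕ< _)) (trans (cong toℕ eq) (FinP.toℕ-fromℕ< _))))

-- Gauss's lemma

odd : ℕ → ℕ
odd h = suc (h ℕ.+ h)

-- The value is -1 where the property holds, so a product of `ε` is -1 to the number of solutions.
ε : ∀ {P : Set} → Dec P → ℤ
ε (yes _) = -1ℤ
ε (no _) = 1ℤ

ε-values : ∀ {P : Set} (P? : Dec P) → ε P? ≡ 1ℤ ⊎ ε P? ≡ -1ℤ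
ε-values (yes _) = inj₂ refl
ε-values (no _) = inj₁ refl

ε-yes : ∀ {P : Set} (P? : Dec P) → P → ε P? ≡ -1ℤ
ε-yes (yes _) _ = refl
ε-yes (no ¬P) P = contradiction P ¬P

ε-no : ∀ {P : Set} (P? : Dec P) → ¬ P → ε P? ≡ 1ℤ
ε-no (yes P) ¬P = contradiction P ¬P
ε-no (no _) _ = refl

ε-cong : ∀ {P Q : Set} (P? : Dec P) (Q? : Dec Q) → (P → Q) → (Q → P) → ε P? ≡ ε Q?
ε-cong (yes P) Q? f _ = sym (ε-yes Q? (f P))
ε-cong (no ¬P) Q? _ g = sym (ε-no Q? (¬P ∘ g))

residue : ℕ → ℤ → ℕ
residue h z = z %ℕ odd h

upper? : ∀ h z → Dec (h ℕ.< residue h z)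
upper? h z = h ℕ.<? residue h z

-- The sign and absolute value of the representative of z in [-h, h].
sgn : ℕ → ℤ → ℤ
sgn h z = ε (upper? h z)

-- The decision is an argument so that one case split settles sign and magnitude together.
fold : ∀ {P : Set} → ℕ → ℕ → Dec P → ℕ
fold h r (yes _) = odd h ℕ.∸ r
fold h r (no _) = r

mag : ℕ → ℤ → ℕ
mag h z = fold h (residue h z) (upper? h z)

residue< : ∀ h z → residue h z ℕ.< odd h
residue< h z = ℤD.n%ℕd<d z (odd h)

residue≅ : ∀ h z → z ≅ + residue h z [ odd h ]
residue≅ h z = ≅-witness (z /ℕ odd h) (ℤD.a≡a%ℕn+[a/ℕn]*n z (odd h))

sgn*mag : ∀ h z → z ≅ sgn h z * + mag h z [ odd h ]
sgn*mag h z = ≅-trans (residue≅ h z) (folded (upper? h z))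
  where
  lemma : ∀ p r → r ≡ -1ℤ * (p - r) + 1ℤ * p
  lemma = solve-∀
  r = residue h z
  folded : ∀ {P : Set} (P? : Dec P) → + r ≅ ε P? * + fold h r P? [ odd h ]
  folded (no _) = ≡⇒≅ (sym (ℤP.*-identityˡ (+ r)))
  folded (yes _) = ≅-witness 1ℤ (trans (lemma (+ odd h) (+ r))
    (cong (λ w → -1ℤ * w + 1ℤ * + odd h) (trans (ℤP.m-n≡m⊖n (odd h) r) (ℤP.⊖-≥ (ℕP.<⇒≤ (residue< h z))))))

mag≤ : ∀ h z → mag h z ℕ.≤ h
mag≤ h z with upper? h z
... | no h≮r = ℕP.≮⇒≥ h≮r
... | yes h<r = ℕP.≤-trans (ℕP.∸-monoʳ-≤ (odd h) h<r) (ℕP.≤-reflexive (ℕP.m+n∸m≡n h h))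

mag>0 : ∀ h z → ¬ z ≅ 0ℤ [ odd h ] → 0 ℕ.< mag h z
mag>0 h z z≇0 with upper? h z
... | no _ = ℕP.n≢0⇒n>0 (λ r≡0 → z≇0 (≅-trans (residue≅ h z) (≡⇒≅ (cong +_ r≡0))))
... | yes _ = ℕP.m<n⇒0<n∸m (residue< h z)

mag-injective : ∀ h y z → mag h y ≡ mag h z → y ≅ z [ odd h ] ⊎ y ≅ - z [ odd h ]
mag-injective h y z eq = cases (ε-values (upper? h y)) (ε-values (upper? h z))
  where
  m = + mag h y
  at : ∀ {s t x w} → s ≡ t → x ≅ s * + w [ odd h ] → x ≅ t * + w [ odd h ]
  at refl = λ c → c
  y≅ : ∀ {s} → sgn h y ≡ s → y ≅ s * m [ odd h ]
  y≅ e = at {w = mag h y} e (sgn*mag h y)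
  z≅ : ∀ {s} → sgn h z ≡ s → z ≅ s * m [ odd h ]
  z≅ {s} e = subst (λ w → z ≅ s * + w [ odd h ]) (sym eq) (at {w = mag h z} e (sgn*mag h z))
  neg : ∀ m → 1ℤ * m ≡ - (-1ℤ * m)
  neg = solve-∀
  neg′ : ∀ m → -1ℤ * m ≡ - (1ℤ * m)
  neg′ = solve-∀
  cases : sgn h y ≡ 1ℤ ⊎ sgn h y ≡ -1ℤ → sgn h z ≡ 1ℤ ⊎ sgn h z ≡ -1ℤ → y ≅ z [ odd h ] ⊎ y ≅ - z [ odd h ]
  cases (inj₁ e) (inj₁ f) = inj₁ (≅-trans (y≅ e) (≅-sym (z≅ f)))
  cases (inj₂ e) (inj₂ f) = inj₁ (≅-trans (y≅ e) (≅-sym (z≅ f)))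
  cases (inj₁ e) (inj₂ f) = inj₂ (≅-trans (y≅ e) (≅-trans (≡⇒≅ (neg m)) (-‿cong (≅-sym (z≅ f)))))
  cases (inj₂ e) (inj₁ f) = inj₂ (≅-trans (y≅ e) (≅-trans (≡⇒≅ (neg′ m)) (-‿cong (≅-sym (z≅ f)))))

≤half⇒<odd : ∀ {h k} → k ℕ.≤ h → k ℕ.< odd h
≤half⇒<odd {h} k≤h = ℕ.s≤s (ℕP.≤-trans k≤h (ℕP.m≤m+n h h))

difference≇0 : ∀ {n i j} → i ℕ.< j → j ℕ.< n → ¬ + j - + i ≅ 0ℤ [ n ]
difference≇0 {n} {i} {j} i<j j<n j-i≅0 = small≇0 (ℕP.m>n⇒m∸n≢0 i<j) (ℕP.≤-<-trans (ℕP.m∸n≤m j i) j<n)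
  (subst (λ w → w ≅ 0ℤ [ n ]) (trans (ℤP.m-n≡m⊖n j i) (ℤP.⊖-≥ (ℕP.<⇒≤ i<j))) j-i≅0)

small-≅⇒≡ : ∀ {n i j} → i ℕ.< n → j ℕ.< n → + i ≅ + j [ n ] → i ≡ j
small-≅⇒≡ {n} {i} {j} i<n j<n i≅j with ℕP.<-cmp i j
... | tri≈ _ i≡j _ = i≡j
... | tri< i<j _ _ = contradiction (≅⇒-≅0 (≅-sym i≅j)) (difference≇0 i<j j<n)
... | tri> _ _ j<i = contradiction (≅⇒-≅0 i≅j) (difference≇0 j<i i<n)

-- Two numbers from 1 to h have a sum strictly between 0 and 2h + 1, so they cannot be opposite.
half-≅± : ∀ {h i j} → i ℕ.< h → j ℕ.< h →
  + suc i ≅ + suc j [ odd h ] ⊎ + suc i ≅ - + suc j [ odd h ] → i ≡ j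
half-≅± i<h j<h (inj₁ i≅j) = ℕP.suc-injective (small-≅⇒≡ (≤half⇒<odd i<h) (≤half⇒<odd j<h) i≅j)
half-≅± {h} {i} {j} i<h j<h (inj₂ i≅-j) = contradiction
  (≅-trans (+-cong i≅-j (≅-refl {x = + suc j})) (≡⇒≅ (ℤP.+-inverseˡ (+ suc j))))
  (small≇0 {k = suc i ℕ.+ suc j} (λ ()) (ℕ.s≤s (ℕP.+-mono-≤ i<h j<h)))

record OddPrime (h : ℕ) : Set where
  constructor oddPrime
  field isPrime : Prime (odd h)

open OddPrime

module _ {h : ℕ} (P : OddPrime h) where

  private
    pp : Prime (odd h)
    pp = isPrime P

  suc≇0 : ∀ k → k ℕ.< h → ¬ + suc k ≅ 0ℤ [ odd h ]
  suc≇0 k k<h = small≇0 (λ ()) (≤half⇒<odd k<h)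

  -- The magnitudes of a, 2a, ..., ha are distinct by `half-≅±`, hence a permutation of 1, ..., h.
  -- Multiplying them all and cancelling h! leaves the signs.
  gauss : ∀ a → ¬ a ≅ 0ℤ [ odd h ] → a ^ h ≅ ∏ h (λ k → sgn h (a * + suc k)) [ odd h ]
  gauss a a≇0 = *-cancelˡ pp (∏ h (λ k → + suc k)) (∏-≇0 pp h (λ k → + suc k) suc≇0) (begin
    ∏ h (λ k → + suc k) * a ^ h
      ≡⟨ ℤP.*-comm _ (a ^ h) ⟩
    a ^ h * ∏ h (λ k → + suc k)
      ≡⟨ cong (_* ∏ h (λ k → + suc k)) (∏-const h a) ⟨
    ∏ h (λ _ → a) * ∏ h (λ k → + suc k)
      ≡⟨ ∏-distrib-* h (λ _ → a) (λ k → + suc k) ⟨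
    ∏ h (λ k → a * + suc k)
      ≈⟨ ∏-cong-≅ h (λ k _ → sgn*mag h (a * + suc k)) ⟩
    ∏ h (λ k → sgn h (a * + suc k) * + mag h (a * + suc k))
      ≡⟨ ∏-distrib-* h (λ k → sgn h (a * + suc k)) (λ k → + mag h (a * + suc k)) ⟩
    signs * ∏ h (λ k → + mag h (a * + suc k))
      ≡⟨ cong (signs *_) (∏-cong h (λ k k<h → cong +_ (sym (suc-σ k k<h)))) ⟩
    signs * ∏ h (λ k → + suc (σ k))
      ≡⟨ cong (signs *_) (∏-rearrange h (λ k → + suc k) σ σ< σ-injective) ⟩
    signs * ∏ h (λ k → + suc k)
      ≡⟨ ℤP.*-comm signs _ ⟩
    ∏ h (λ k → + suc k) * signs ∎)
    where
    open SetoidReasoning (≅-setoid (odd h))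
    signs : ℤ
    signs = ∏ h (λ k → sgn h (a * + suc k))
    -- Factors are indexed from 0, so the permutation of 1, ..., h is shifted down by one.
    σ : ℕ → ℕ
    σ k = ℕ.pred (mag h (a * + suc k))
    suc-σ : ∀ k → k ℕ.< h → suc (σ k) ≡ mag h (a * + suc k)
    suc-σ k k<h = ℕP.suc-pred _ {{ℕ.>-nonZero (mag>0 h (a * + suc k) (*-≇0 pp a≇0 (suc≇0 k k<h)))}}
    σ< : ∀ k → k ℕ.< h → σ k ℕ.< h
    σ< k k<h = subst (ℕ._≤ h) (sym (suc-σ k k<h)) (mag≤ h (a * + suc k))
    cancel : ∀ i j → a * + suc i ≅ - (a * + suc j) [ odd h ] → + suc i ≅ - + suc j [ odd h ]
    cancel i j c = *-cancelˡ pp a a≇0 (≅-trans c (≡⇒≅ (ℤP.neg-distribʳ-* a (+ suc j))))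
    σ-injective : ∀ i j → i ℕ.< h → j ℕ.< h → σ i ≡ σ j → i ≡ j
    σ-injective i j i<h j<h eq = half-≅± i<h j<h
      (Sum.map (*-cancelˡ pp a a≇0) (cancel i j)
        (mag-injective h (a * + suc i) (a * + suc j)
          (trans (sym (suc-σ i i<h)) (trans (cong suc eq) (suc-σ j j<h)))))

-- Polynomial functions and Euler's criterion

-- f is, modulo p, a polynomial function of degree at most n whose coefficient
-- of degree n is l; the recursion is division by X - r.
Poly : ℕ → ℕ → ℤ → (ℤ → ℤ) → Set
Poly p zero l f = ∀ x → f x ≅ l [ p ]
Poly p (suc n) l f = ∀ r → ∃ λ g → Poly p n l g × (∀ x → f x ≅ (x - r) * g x + f r [ p ])

module _ {p : ℕ} where

  poly-+ : ∀ n {l m f g} → Poly p n l f → Poly p n m g → Poly p n (l + m) (λ x → f x + g x)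
  poly-+ zero F G x = +-cong (F x) (G x)
  poly-+ (suc n) {f = f} {g} F G r =
    let f′ , F′ , f≅ = F r
        g′ , G′ , g≅ = G r
    in (λ x → f′ x + g′ x) , poly-+ n F′ G′ ,
       λ x → ≅-trans (+-cong (f≅ x) (g≅ x)) (≡⇒≅ (lemma (x - r) (f′ x) (g′ x) (f r) (g r)))
    where
    lemma : ∀ x f′ g′ f g → x * f′ + f + (x * g′ + g) ≡ x * (f′ + g′) + (f + g)
    lemma = solve-∀

  poly-* : ∀ n c {l f} → Poly p n l f → Poly p n (c * l) (λ x → c * f x)
  poly-* zero c F x = *-congˡ c (F x)
  poly-* (suc n) c {f = f} F r =
    let f′ , F′ , f≅ = F r
    in (λ x → c * f′ x) , poly-* n c F′ ,
       λ x → ≅-trans (*-congˡ c (f≅ x)) (≡⇒≅ (lemma c (x - r) (f′ x) (f r)))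
    where
    lemma : ∀ c x f′ f → c * (x * f′ + f) ≡ x * (c * f′) + c * f
    lemma = solve-∀

  poly-cong : ∀ n {l m f} → l ≡ m → Poly p n l f → Poly p n m f
  poly-cong n refl F = F

  poly-lift : ∀ n {l f} → Poly p n l f → Poly p (suc n) 0ℤ f
  poly-lift zero {l} {f} F r = (λ _ → 0ℤ) , (λ _ → ≅-refl) ,
    λ x → ≅-trans (F x) (≅-trans (≅-sym (F r)) (≡⇒≅ (lemma (x - r) (f r))))
    where
    lemma : ∀ x f → f ≡ x * 0ℤ + f
    lemma = solve-∀
  poly-lift (suc n) F r = let g , G , f≅ = F r in g , poly-lift n G , f≅

  poly-const : ∀ n c → Poly p (suc n) 0ℤ (λ _ → c)
  poly-const zero c = poly-lift 0 (λ _ → ≅-refl {x = c})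
  poly-const (suc n) c = poly-lift (suc n) (poly-const n c)

  poly-^ : ∀ n → Poly p n 1ℤ (_^ n)
  poly-^ zero x = ≅-refl
  poly-^ (suc zero) r = (λ _ → 1ℤ) , (λ _ → ≅-refl) , λ x → ≡⇒≅ (lemma x r)
    where
    lemma : ∀ x r → x * 1ℤ ≡ (x - r) * 1ℤ + r * 1ℤ
    lemma = solve-∀
  poly-^ (suc (suc n)) r =
    let g , G , x^n≅ = poly-^ (suc n) r
    -- The quotient comes from x · x^(n+1) = (x - r) x^(n+1) + r x^(n+1), where the last power is
    -- divided recursively.
    in (λ x → x ^ suc n + r * g x) ,
       poly-cong (suc n) (cong (λ z → 1ℤ + z) (ℤP.*-zeroʳ r)) (poly-+ (suc n) (poly-^ (suc n)) (poly-* (suc n) r (poly-lift n G))) ,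
       λ x → ≅-trans (≡⇒≅ (split x r (x ^ suc n)))
         (≅-trans (+-cong (≅-refl {x = (x - r) * x ^ suc n}) (*-congˡ r (x^n≅ x)))
                  (≡⇒≅ (regroup (x - r) r (x ^ suc n) (g x) (r ^ suc n))))
    where
    split : ∀ x r y → x * y ≡ (x - r) * y + r * y
    split = solve-∀
    regroup : ∀ u r y g z → u * y + r * (u * g + z) ≡ u * (y + r * g) + r * z
    regroup = solve-∀

  -- Dividing by X - r 0 keeps the leading coefficient. As p is prime and the roots are distinct,
  -- the remaining ones are roots of the quotient.
  lagrange : Prime p → ∀ n {l f} → Poly p n l f → (r : ℕ → ℤ) →
    (∀ {i j} → i ℕ.< j → j ℕ.≤ n → ¬ r i ≅ r j [ p ]) →
    (∀ i → i ℕ.≤ n → f (r i) ≅ 0ℤ [ p ]) → l ≅ 0ℤ [ p ]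
  lagrange pp zero F r _ root = ≅-trans (≅-sym (F (r 0))) (root 0 ℕ.z≤n)
  lagrange pp (suc n) {f = f} F r distinct root =
    let g , G , f≅ = F (r 0)
    in lagrange pp n G (r ∘ suc) (λ i<j j≤n → distinct (ℕ.s≤s i<j) (ℕ.s≤s j≤n))
         λ i i≤n → Sum.[ (λ r≅ → contradiction (≅-sym (-≅0⇒≅ r≅)) (distinct (ℕ.s≤s ℕ.z≤n) (ℕ.s≤s i≤n))) , (λ c → c) ]′
           (*≅0 pp (r (suc i) - r 0) (g (r (suc i)))
             (≅-trans (≡⇒≅ (lemma ((r (suc i) - r 0) * g (r (suc i))) (f (r 0))))
               (+-cong (≅-trans (≅-sym (f≅ (r (suc i)))) (root (suc i) (ℕ.s≤s i≤n)))
                       (-‿cong (root 0 ℕ.z≤n)))))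
    where
    lemma : ∀ u v → u ≡ u + v - v
    lemma = solve-∀

±1 : ℤ → Set
±1 s = s ≡ 1ℤ ⊎ s ≡ -1ℤ

±1-* : ∀ {s t} → ±1 s → ±1 t → ±1 (s * t)
±1-* (inj₁ refl) (inj₁ refl) = inj₁ refl
±1-* (inj₁ refl) (inj₂ refl) = inj₂ refl
±1-* (inj₂ refl) (inj₁ refl) = inj₂ refl
±1-* (inj₂ refl) (inj₂ refl) = inj₁ refl

±1-square : ∀ {s} → ±1 s → s * s ≡ 1ℤ
±1-square (inj₁ refl) = refl
±1-square (inj₂ refl) = refl

∏-±1 : ∀ n f → (∀ k → ±1 (f k)) → ±1 (∏ n f)
∏-±1 zero f _ = inj₁ refl
∏-±1 (suc n) f f±1 = ±1-* (f±1 0) (∏-±1 n (f ∘ suc) (f±1 ∘ suc))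

legendre-cases : ∀ x p →
  (p ℕD.∣ ∣ x ∣ × legendre x p ≡ 0ℤ) ⊎
  (¬ p ℕD.∣ ∣ x ∣ × IsSquareMod x p × legendre x p ≡ 1ℤ) ⊎
  (¬ p ℕD.∣ ∣ x ∣ × ¬ IsSquareMod x p × legendre x p ≡ -1ℤ)
legendre-cases x p with p ℕD.∣? ∣ x ∣
... | yes p∣x = inj₁ (p∣x , refl)
... | no p∤x with isSquareMod? x p
...   | yes sq = inj₂ (inj₁ (p∤x , sq , refl))
...   | no ¬sq = inj₂ (inj₂ (p∤x , ¬sq , refl))

Trit : ℤ → Set
Trit x = x ≡ 0ℤ ⊎ x ≡ 1ℤ ⊎ x ≡ -1ℤ

legendre-trit : ∀ x p → Trit (legendre x p)
legendre-trit x p = Sum.map proj₂ (Sum.map (proj₂ ∘ proj₂) (proj₂ ∘ proj₂)) (legendre-cases x p)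

trit-* : ∀ {x y} → Trit x → Trit y → Trit (x * y)
trit-* (inj₁ refl) _ = inj₁ refl
trit-* {x} (inj₂ _) (inj₁ refl) = inj₁ (ℤP.*-zeroʳ x)
trit-* (inj₂ (inj₁ refl)) (inj₂ (inj₁ refl)) = inj₂ (inj₁ refl)
trit-* (inj₂ (inj₁ refl)) (inj₂ (inj₂ refl)) = inj₂ (inj₂ refl)
trit-* (inj₂ (inj₂ refl)) (inj₂ (inj₁ refl)) = inj₂ (inj₂ refl)
trit-* (inj₂ (inj₂ refl)) (inj₂ (inj₂ refl)) = inj₂ (inj₁ refl)

-- Distinct values among 0, 1, -1 differ by 1 or 2, and n > 2 divides neither. This turns
-- congruences between symbols into equalities.
trit-≅⇒≡ : ∀ {n x y} → 2 ℕ.< n → Trit x → Trit y → x ≅ y [ n ] → x ≡ y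
trit-≅⇒≡ {n} 2<n = compare
  where
  1≇0 : ¬ n ℕD.∣ 1
  1≇0 d = ℕP.<⇒≱ 2<n (ℕP.≤-trans (ℕD.∣⇒≤ d) (ℕ.s≤s ℕ.z≤n))
  2≇0 : ¬ n ℕD.∣ 2
  2≇0 d = ℕP.<⇒≱ 2<n (ℕD.∣⇒≤ d)
  compare : ∀ {x y} → Trit x → Trit y → x ≅ y [ n ] → x ≡ y
  compare (inj₁ refl) (inj₁ refl) _ = refl
  compare (inj₁ refl) (inj₂ (inj₁ refl)) c = ⊥-elim (1≇0 (≅⇒∣ c))
  compare (inj₁ refl) (inj₂ (inj₂ refl)) c = ⊥-elim (1≇0 (≅⇒∣ c))
  compare (inj₂ (inj₁ refl)) (inj₁ refl) c = ⊥-elim (1≇0 (≅⇒∣ c))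
  compare (inj₂ (inj₁ refl)) (inj₂ (inj₁ refl)) _ = refl
  compare (inj₂ (inj₁ refl)) (inj₂ (inj₂ refl)) c = ⊥-elim (2≇0 (≅⇒∣ c))
  compare (inj₂ (inj₂ refl)) (inj₁ refl) c = ⊥-elim (1≇0 (≅⇒∣ c))
  compare (inj₂ (inj₂ refl)) (inj₂ (inj₁ refl)) c = ⊥-elim (2≇0 (≅⇒∣ c))
  compare (inj₂ (inj₂ refl)) (inj₂ (inj₂ refl)) _ = refl

prime-odd⇒half>0 : ∀ {h} → OddPrime h → 0 ℕ.< h
prime-odd⇒half>0 {zero} P = contradiction (isPrime P) ¬prime[1]
prime-odd⇒half>0 {suc h} _ = ℕ.s≤s ℕ.z≤n

0^n≡0 : ∀ {n} → 0 ℕ.< n → 0ℤ ^ n ≡ 0ℤ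
0^n≡0 {suc n} _ = refl

module _ {h : ℕ} (P : OddPrime h) where

  private
    pp : Prime (odd h)
    pp = isPrime P

    h>0 : 0 ℕ.< h
    h>0 = prime-odd⇒half>0 P

    2<p : 2 ℕ.< odd h
    2<p = ℕ.s≤s (ℕP.+-mono-≤ h>0 h>0)

  1≇0 : ¬ 1ℤ ≅ 0ℤ [ odd h ]
  1≇0 = small≇0 (λ ()) (ℕP.<-trans (ℕP.n<1+n 1) 2<p)

  2≇0 : ¬ + 2 ≅ 0ℤ [ odd h ]
  2≇0 = small≇0 (λ ()) 2<p

  gauss-signs : ℤ → ℤ
  gauss-signs a = ∏ h (λ k → sgn h (a * + suc k))

  gauss-signs-±1 : ∀ a → ±1 (gauss-signs a)
  gauss-signs-±1 a = ∏-±1 h _ (λ k → ε-values (upper? h (a * + suc k)))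

  -- By Gauss's lemma a^h is a sign, and its square is 1.
  fermat : ∀ a → ¬ a ≅ 0ℤ [ odd h ] → a ^ h * a ^ h ≅ 1ℤ [ odd h ]
  fermat a a≇0 = ≅-trans (*-cong (gauss P a a≇0) (gauss P a a≇0)) (≡⇒≅ (±1-square (gauss-signs-±1 a)))

  square-^ : ∀ y → ¬ y ≅ 0ℤ [ odd h ] → (y * y) ^ h ≅ 1ℤ [ odd h ]
  square-^ y y≇0 = ≅-trans (≡⇒≅ (*-^-distrib y y h)) (fermat y y≇0)

  -- If a^h were 1, then a together with 1², ..., h² would be h + 1 distinct roots of X^h - 1.
  nonsquare-^ : ∀ a → ¬ a ≅ 0ℤ [ odd h ] → (∀ y → ¬ a ≅ y * y [ odd h ]) → a ^ h ≅ -1ℤ [ odd h ]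
  nonsquare-^ a a≇0 nonsquare = Sum.[ impossible , (λ e → ≅-trans (gauss P a a≇0) (≡⇒≅ e)) ]′ (gauss-signs-±1 a)
    where
    roots : ℕ → ℤ
    roots zero = a
    roots (suc i) = + suc i * + suc i
    factor : ∀ x y → (x - y) * (x - - y) ≡ x * x - y * y
    factor = solve-∀
    distinct : ∀ {i j} → i ℕ.< j → j ℕ.≤ h → ¬ roots i ≅ roots j [ odd h ]
    distinct {zero} {suc j} _ _ c = nonsquare (+ suc j) c
    distinct {suc i} {suc j} (ℕ.s≤s i<j) j<h c = ℕP.<⇒≢ i<j (half-≅± (ℕP.<-trans i<j j<h) j<h
      (Sum.map -≅0⇒≅ -≅0⇒≅ (*≅0 pp (+ suc i - + suc j) (+ suc i - - + suc j)
        (≅-trans (≡⇒≅ (factor (+ suc i) (+ suc j))) (≅⇒-≅0 c)))))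
    poly : Poly (odd h) h 1ℤ (λ x → x ^ h + -1ℤ)
    poly = subst (λ n → Poly (odd h) n 1ℤ (λ x → x ^ n + -1ℤ)) (ℕP.suc-pred h {{ℕ.>-nonZero h>0}})
      (poly-+ (suc (ℕ.pred h)) (poly-^ (suc (ℕ.pred h))) (poly-const (ℕ.pred h) -1ℤ))
    impossible : gauss-signs a ≡ 1ℤ → a ^ h ≅ -1ℤ [ odd h ]
    impossible e = contradiction (lagrange pp h poly roots distinct root) 1≇0
      where
      root : ∀ i → i ℕ.≤ h → roots i ^ h + -1ℤ ≅ 0ℤ [ odd h ]
      root zero _ = +-cong (≅-trans (gauss P a a≇0) (≡⇒≅ e)) (≅-refl {x = -1ℤ})
      root (suc i) i<h = +-cong (square-^ (+ suc i) (suc≇0 P i i<h)) (≅-refl {x = -1ℤ})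

  euler : ∀ x → legendre x (odd h) ≅ x ^ h [ odd h ]
  euler x = cases (legendre-cases x (odd h))
    where
    square⇒IsSquareMod : ∀ y → x ≅ y * y [ odd h ] → IsSquareMod x (odd h)
    square⇒IsSquareMod y x≅y² = lose (∈-upTo⁺ (residue< h y))
      (≅⇒∣ (≅-trans (*-cong (≅-sym (residue≅ h y)) (≅-sym (residue≅ h y))) (≅-sym x≅y²)))
    cases : _ → legendre x (odd h) ≅ x ^ h [ odd h ]
    cases (inj₁ (p∣x , e)) =
      ≅-trans (≡⇒≅ (trans e (sym (0^n≡0 h>0)))) (^-cong h (≅-sym (∣⇒≅0 p∣x)))
    cases (inj₂ (inj₁ (p∤x , sq , e))) = let y , d = satisfied sq in
      ≅-trans (≡⇒≅ e) (≅-trans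
        (≅-sym (square-^ (+ y) (λ y≅0 → p∤x (≅0⇒∣ (≅-trans (≅-sym (∣⇒≅ d)) (*-cong y≅0 y≅0))))))
        (^-cong h (∣⇒≅ {x = + y * + y} {y = x} d)))
    cases (inj₂ (inj₂ (p∤x , ¬sq , e))) =
      ≅-trans (≡⇒≅ e) (≅-sym (nonsquare-^ x (p∤x ∘ ≅0⇒∣) (λ y c → ¬sq (square⇒IsSquareMod y c))))

  legendre-unique : ∀ x {s} → Trit s → s ≅ x ^ h [ odd h ] → legendre x (odd h) ≡ s
  legendre-unique x t c = trit-≅⇒≡ 2<p (legendre-trit x (odd h)) t (≅-trans (euler x) (≅-sym c))

  legendre-cong : ∀ {x y} → x ≅ y [ odd h ] → legendre x (odd h) ≡ legendre y (odd h)
  legendre-cong {x} {y} c = legendre-unique x (legendre-trit y (odd h)) (≅-trans (euler y) (^-cong h (≅-sym c)))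

  legendre-* : ∀ x y → legendre (x * y) (odd h) ≡ legendre x (odd h) * legendre y (odd h)
  legendre-* x y = legendre-unique (x * y) (trit-* (legendre-trit x (odd h)) (legendre-trit y (odd h)))
    (≅-trans (*-cong (euler x) (euler y)) (≡⇒≅ (sym (*-^-distrib x y h))))

  legendre-1 : legendre 1ℤ (odd h) ≡ 1ℤ
  legendre-1 = legendre-unique 1ℤ (inj₂ (inj₁ refl)) (≡⇒≅ (sym (ℤP.^-zeroˡ h)))

  legendre-square : ∀ y → ¬ y ≅ 0ℤ [ odd h ] → legendre (y * y) (odd h) ≡ 1ℤ
  legendre-square y y≇0 = legendre-unique (y * y) (inj₂ (inj₁ refl)) (≅-sym (square-^ y y≇0))

  legendre-gauss : ∀ a → ¬ a ≅ 0ℤ [ odd h ] → legendre a (odd h) ≡ gauss-signs a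
  legendre-gauss a a≇0 = legendre-unique a (inj₂ (gauss-signs-±1 a)) (≅-sym (gauss P a a≇0))

-- Quadratic reciprocity

-- The condition 0 < A - B ≤ h, written without subtraction.
Above : ℕ → ℕ → ℕ → Set
Above h A B = B ℕ.< A × A ℕ.≤ B ℕ.+ h

above? : ∀ h A B → Dec (Above h A B)
above? h A B = (B ℕ.<? A) ×-dec (A ℕ.≤? B ℕ.+ h)

module _ (h z : ℕ) where

  private
    p r Q : ℕ
    p = odd h
    r = z ℕ.% odd h
    Q = z ℕ./ odd h

    z≡ : z ≡ r ℕ.+ Q ℕ.* p
    z≡ = ℕDM.m≡m%n+[m/n]*n z (odd h)

    r<p : r ℕ.< p
    r<p = ℕDM.m%n<n z (odd h)

  -- The next multiple of p above z is p(Q + 1), and an interval of length h < p has no room for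
  -- another.
  above⇒quotient : ∀ y → Above h (p ℕ.* suc y) z → y ≡ Q
  above⇒quotient y (z<py , py≤z+h) = ℕP.≤-antisym y≤Q Q≤y
    where
    open ℕP.≤-Reasoning
    Q≤y : Q ℕ.≤ y
    Q≤y = ℕ.s≤s⁻¹ (ℕP.*-cancelˡ-< p Q (suc y) (begin-strict
      p ℕ.* Q        ≡⟨ ℕP.*-comm p Q ⟩
      Q ℕ.* p        ≤⟨ ℕP.m≤n+m (Q ℕ.* p) r ⟩
      r ℕ.+ Q ℕ.* p  ≡⟨ z≡ ⟨
      z              <⟨ z<py ⟩
      p ℕ.* suc y    ∎))
    y≤Q : y ℕ.≤ Q
    y≤Q = ℕ.s≤s⁻¹ (ℕ.s≤s⁻¹ (ℕP.*-cancelˡ-< p (suc y) (2 ℕ.+ Q) (begin-strict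
      p ℕ.* suc y                ≤⟨ py≤z+h ⟩
      z ℕ.+ h                    ≡⟨ cong (ℕ._+ h) z≡ ⟩
      r ℕ.+ Q ℕ.* p ℕ.+ h        <⟨ ℕP.+-mono-<-≤ (ℕP.+-monoˡ-< (Q ℕ.* p) r<p) (ℕP.<⇒≤ (≤half⇒<odd (ℕP.≤-refl {h}))) ⟩
      p ℕ.+ Q ℕ.* p ℕ.+ p        ≡⟨ lemma p Q ⟩
      p ℕ.* (2 ℕ.+ Q)            ∎)))
      where
      lemma : ∀ p Q → p ℕ.+ Q ℕ.* p ℕ.+ p ≡ p ℕ.* (2 ℕ.+ Q)
      lemma = ℕRing.solve-∀

  -- The distance p(Q + 1) - z is p - r, which is at most h exactly when r exceeds h.
  above-quotient⇒upper : Above h (p ℕ.* suc Q) z → h ℕ.< r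
  above-quotient⇒upper (_ , pQ≤z+h) = ℕP.+-cancelʳ-≤ (h ℕ.+ Q ℕ.* p) (suc h) r (begin
    suc h ℕ.+ (h ℕ.+ Q ℕ.* p)  ≡⟨ lemma h Q ⟩
    p ℕ.* suc Q                ≤⟨ pQ≤z+h ⟩
    z ℕ.+ h                    ≡⟨ cong (ℕ._+ h) z≡ ⟩
    r ℕ.+ Q ℕ.* p ℕ.+ h        ≡⟨ ℕP.+-assoc r (Q ℕ.* p) h ⟩
    r ℕ.+ (Q ℕ.* p ℕ.+ h)      ≡⟨ cong (r ℕ.+_) (ℕP.+-comm (Q ℕ.* p) h) ⟩
    r ℕ.+ (h ℕ.+ Q ℕ.* p)      ∎)
    where
    open ℕP.≤-Reasoning
    lemma : ∀ h Q → suc h ℕ.+ (h ℕ.+ Q ℕ.* suc (h ℕ.+ h)) ≡ suc (h ℕ.+ h) ℕ.* suc Q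
    lemma = ℕRing.solve-∀

  upper⇒above-quotient : h ℕ.< r → Above h (p ℕ.* suc Q) z
  upper⇒above-quotient h<r = z<pQ , pQ≤z+h
    where
    open ℕP.≤-Reasoning
    z<pQ : z ℕ.< p ℕ.* suc Q
    z<pQ = begin-strict
      z               ≡⟨ z≡ ⟩
      r ℕ.+ Q ℕ.* p   <⟨ ℕP.+-monoˡ-< (Q ℕ.* p) r<p ⟩
      suc Q ℕ.* p     ≡⟨ ℕP.*-comm (suc Q) p ⟩
      p ℕ.* suc Q     ∎
    pQ≤z+h : p ℕ.* suc Q ℕ.≤ z ℕ.+ h
    pQ≤z+h = begin
      p ℕ.* suc Q                ≡⟨ lemma h Q ⟩
      suc h ℕ.+ Q ℕ.* p ℕ.+ h    ≤⟨ ℕP.+-monoˡ-≤ h (ℕP.+-monoˡ-≤ (Q ℕ.* p) h<r) ⟩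
      r ℕ.+ Q ℕ.* p ℕ.+ h        ≡⟨ cong (ℕ._+ h) z≡ ⟨
      z ℕ.+ h                    ∎
      where
      lemma : ∀ h Q → suc (h ℕ.+ h) ℕ.* suc Q ≡ suc h ℕ.+ Q ℕ.* suc (h ℕ.+ h) ℕ.+ h
      lemma = ℕRing.solve-∀

  -- z lies in the upper half modulo p exactly when some multiple of p lies within h above z.
  sgn-∏ : ∀ n → (h ℕ.< r → Q ℕ.< n) → sgn h (+ z) ≡ ∏ n (λ y → ε (above? h (p ℕ.* suc y) z))
  sgn-∏ n Q<n = cases (h ℕ.<? r)
    where
    cases : Dec (h ℕ.< r) → sgn h (+ z) ≡ ∏ n (λ y → ε (above? h (p ℕ.* suc y) z))
    cases (yes h<r) = trans (ε-yes (upper? h (+ z)) h<r) (sym (trans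
      (∏-single n _ Q (Q<n h<r) (λ y _ y≢Q → ε-no (above? h (p ℕ.* suc y) z) (y≢Q ∘ above⇒quotient y)))
      (ε-yes (above? h (p ℕ.* suc Q) z) (upper⇒above-quotient h<r))))
    cases (no h≮r) = trans (ε-no (upper? h (+ z)) h≮r) (sym
      (∏-one n _ (λ y _ → ε-no (above? h (p ℕ.* suc y) z) (λ a →
        h≮r (above-quotient⇒upper (subst (λ w → Above h (p ℕ.* suc w) z) (above⇒quotient y a) a))))))

-- From (2k+1)(x+1) ≤ (2k+1)h only the multiples p, 2p, ..., kp can matter. The index set becomes an
-- h by k rectangle, which both primes share.
upper⇒quotient< : ∀ h k x → x ℕ.< h → h ℕ.< (odd k ℕ.* suc x) ℕ.% odd h → (odd k ℕ.* suc x) ℕ./ odd h ℕ.< k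
upper⇒quotient< h k x x<h h<r = ℕP.*-cancelʳ-< (odd h) Q k (ℕP.+-cancelˡ-< (suc h) _ _ (begin-strict
    suc h ℕ.+ Q ℕ.* odd h                ≤⟨ ℕP.+-monoˡ-≤ (Q ℕ.* odd h) h<r ⟩
    z ℕ.% odd h ℕ.+ Q ℕ.* odd h          ≡⟨ ℕDM.m≡m%n+[m/n]*n z (odd h) ⟨
    odd k ℕ.* suc x                      ≤⟨ ℕP.*-monoʳ-≤ (odd k) x<h ⟩
    odd k ℕ.* h                          ≤⟨ ℕP.m≤m+n _ k ⟩
    odd k ℕ.* h ℕ.+ k                    <⟨ ℕP.n<1+n _ ⟩
    suc (odd k ℕ.* h ℕ.+ k)              ≡⟨ lemma h k ⟩
    suc h ℕ.+ k ℕ.* odd h                ∎))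
  where
  open ℕP.≤-Reasoning
  z = odd k ℕ.* suc x
  Q = z ℕ./ odd h
  lemma : ∀ h k → suc (suc (k ℕ.+ k) ℕ.* h ℕ.+ k) ≡ suc h ℕ.+ k ℕ.* suc (h ℕ.+ h)
  lemma = ℕRing.solve-∀

-- Gauss's lemma in lattice form: with p = 2h + 1 and q = 2k + 1, the symbol is -1 to the number of
-- points 1 ≤ x ≤ h, 1 ≤ y ≤ k with 0 < py - qx ≤ h.
legendre-∏ : ∀ {h} → OddPrime h → ∀ k → ¬ + odd k ≅ 0ℤ [ odd h ] →
  legendre (+ odd k) (odd h) ≡ ∏ h (λ x → ∏ k (λ y → ε (above? h (odd h ℕ.* suc y) (odd k ℕ.* suc x))))
legendre-∏ {h} P k q≇0 = trans (legendre-gauss P (+ odd k) q≇0) (∏-cong h (λ x x<h →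
  trans (cong (sgn h) (sym (ℤP.pos-* (odd k) (suc x))))
        (sgn-∏ h (odd k ℕ.* suc x) k (upper⇒quotient< h k x x<h))))

-- The strip -k ≤ A - B ≤ h. Off the line A = B it is the union of the strips that belong to the two
-- symbols.
Near : ℕ → ℕ → ℕ → ℕ → Set
Near h k A B = A ℕ.≤ B ℕ.+ h × B ℕ.≤ A ℕ.+ k

near? : ∀ h k A B → Dec (Near h k A B)
near? h k A B = (A ℕ.≤? B ℕ.+ h) ×-dec (B ℕ.≤? A ℕ.+ k)

-- The two strips lie on opposite sides of A = B, so at most one factor is -1.
above*above : ∀ h k A B → A ≢ B → ε (above? h A B) * ε (above? k B A) ≡ ε (near? h k A B)
above*above h k A B A≢B with ℕP.<-cmp A B
... | tri≈ _ A≡B _ = contradiction A≡B A≢B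
... | tri< A<B _ B≮A = trans (cong (_* ε (above? k B A)) (ε-no (above? h A B) (B≮A ∘ proj₁)))
  (trans (ℤP.*-identityˡ _) (ε-cong (above? k B A) (near? h k A B)
    (λ a → ℕP.≤-trans (ℕP.<⇒≤ A<B) (ℕP.m≤m+n B h) , proj₂ a) (λ n → A<B , proj₂ n)))
... | tri> A≮B _ B<A = trans (cong (ε (above? h A B) *_) (ε-no (above? k B A) (A≮B ∘ proj₁)))
  (trans (ℤP.*-identityʳ _) (ε-cong (above? h A B) (near? h k A B)
    (λ a → proj₂ a , ℕP.≤-trans (ℕP.<⇒≤ B<A) (ℕP.m≤m+n A k)) (λ n → B<A , proj₁ n)))

≤-balance : ∀ {A A′ B B′} → A ℕ.+ A′ ≡ B ℕ.+ B′ → A ℕ.≤ B → B′ ℕ.≤ A′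
≤-balance {A} {A′} {B} {B′} eq A≤B =
  ℕP.+-cancelˡ-≤ B B′ A′ (ℕP.≤-trans (ℕP.≤-reflexive (sym eq)) (ℕP.+-monoˡ-≤ A′ A≤B))

-- The equation says that A - B and A′ - B′ add up to h - k, and t ↦ h - k - t exchanges the bounds
-- -k and h.
near-reflect : ∀ h k {A A′ B B′} → A ℕ.+ A′ ℕ.+ k ≡ B ℕ.+ B′ ℕ.+ h → Near h k A B → Near h k A′ B′
near-reflect h k {A} {A′} {B} {B′} eq (A≤B+h , B≤A+k) =
    ≤-balance (trans (shuffle B B′ h) (trans (sym eq) (shuffle′ A A′ k))) B≤A+k
  , ≤-balance (trans (shuffle A A′ k) (trans eq (shuffle′ B B′ h))) A≤B+h
  where
  shuffle : ∀ x y z → x ℕ.+ (y ℕ.+ z) ≡ x ℕ.+ y ℕ.+ z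
  shuffle = ℕRing.solve-∀
  shuffle′ : ∀ x y z → x ℕ.+ y ℕ.+ z ≡ x ℕ.+ z ℕ.+ y
  shuffle′ = ℕRing.solve-∀

reflect-index : ∀ {n i} → i ℕ.< n → suc i ℕ.+ suc (n ℕ.∸ suc i) ≡ suc n
reflect-index {n} {i} i<n = trans (ℕP.+-suc (suc i) (n ℕ.∸ suc i)) (cong suc (ℕP.m+[n∸m]≡n i<n))

-- Reflection in the centre of the rectangle meets the condition of `near-reflect`, because
-- (2h+1)(k+1) + k = 2hk + 2h + 2k + 1 is symmetric in h and k.
reflect-sum : ∀ h k x y → x ℕ.< h → y ℕ.< k →
  odd h ℕ.* suc y ℕ.+ odd h ℕ.* suc (k ℕ.∸ suc y) ℕ.+ k ≡
  odd k ℕ.* suc x ℕ.+ odd k ℕ.* suc (h ℕ.∸ suc x) ℕ.+ h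
reflect-sum h k x y x<h y<k = begin
  odd h ℕ.* suc y ℕ.+ odd h ℕ.* suc (k ℕ.∸ suc y) ℕ.+ k
    ≡⟨ cong (ℕ._+ k) (ℕP.*-distribˡ-+ (odd h) (suc y) _) ⟨
  odd h ℕ.* (suc y ℕ.+ suc (k ℕ.∸ suc y)) ℕ.+ k
    ≡⟨ cong (λ w → odd h ℕ.* w ℕ.+ k) (reflect-index y<k) ⟩
  odd h ℕ.* suc k ℕ.+ k
    ≡⟨ lemma h k ⟩
  odd k ℕ.* suc h ℕ.+ h
    ≡⟨ cong (λ w → odd k ℕ.* w ℕ.+ h) (reflect-index x<h) ⟨
  odd k ℕ.* (suc x ℕ.+ suc (h ℕ.∸ suc x)) ℕ.+ h
    ≡⟨ cong (ℕ._+ h) (ℕP.*-distribˡ-+ (odd k) (suc x) _) ⟩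
  odd k ℕ.* suc x ℕ.+ odd k ℕ.* suc (h ℕ.∸ suc x) ℕ.+ h ∎
  where
  open ≡-Reasoning
  lemma : ∀ h k → suc (h ℕ.+ h) ℕ.* suc k ℕ.+ k ≡ suc (k ℕ.+ k) ℕ.* suc h ℕ.+ h
  lemma = ℕRing.solve-∀

∏-palindrome : ∀ j f → (∀ i → i ℕ.< j ℕ.+ j → f (j ℕ.+ j ℕ.∸ suc i) ≡ f i) →
  ∏ (j ℕ.+ j) f ≡ ∏ j f * ∏ j f
∏-palindrome j f f-reflect = trans (∏-split j j f) (cong (∏ j f *_)
  (trans (∏-reverse j (λ i → f (j ℕ.+ i))) (∏-cong j (λ i i<j →
    trans (cong f (sym (ℕP.+-∸-assoc j i<j))) (f-reflect i (ℕP.<-≤-trans i<j (ℕP.m≤m+n j j)))))))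

module _ {h k : ℕ} (P : OddPrime h) (Q : OddPrime k) (h≢k : h ≢ k) where

  odd≇0 : ¬ + odd k ≅ 0ℤ [ odd h ]
  odd≇0 c with prime⇒irreducible (isPrime Q) (≅0⇒∣ c)
  ... | inj₁ p≡1 = contradiction (isPrime P) (λ pp → ¬prime[1] (subst Prime p≡1 pp))
  ... | inj₂ p≡q = h≢k (ℕP.*-cancelˡ-≡ h k 2
    (trans (cong (h ℕ.+_) (ℕP.+-identityʳ h)) (trans (ℕP.suc-injective p≡q) (cong (k ℕ.+_) (sym (ℕP.+-identityʳ k))))))

  -- A lattice point on the diagonal would make p divide q(x + 1), but q is another prime and x + 1
  -- < p.
  multiples≢ : ∀ x y → x ℕ.< h → odd h ℕ.* suc y ≢ odd k ℕ.* suc x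
  multiples≢ x y x<h eq = Sum.[ odd≇0 , suc≇0 P x x<h ]′ (*≅0 (isPrime P) (+ odd k) (+ suc x)
    (≅-trans (≡⇒≅ (sym (ℤP.pos-* (odd k) (suc x)))) (∣⇒≅0 (ℕD.divides (suc y) (trans (sym eq) (ℕP.*-comm (odd h) (suc y)))))))

-- The product of the symbols is the sign of the symmetric strip. The central reflection pairs row x
-- with its mirror image. As h = 2j is even, no row is its own mirror image, so the total is the
-- square of a sign.
reciprocity-≢ : ∀ j {k} → OddPrime (j ℕ.+ j) → OddPrime k → j ℕ.+ j ≢ k →
  legendre (+ odd k) (odd (j ℕ.+ j)) * legendre (+ odd (j ℕ.+ j)) (odd k) ≡ 1ℤ
reciprocity-≢ j {k} P Q h≢k = begin
  legendre (+ odd k) (odd h) * legendre (+ odd h) (odd k)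
    ≡⟨ cong₂ _*_ (legendre-∏ P k (odd≇0 P Q h≢k)) (legendre-∏ Q h (odd≇0 Q P (h≢k ∘ sym))) ⟩
  ∏ h (λ x → ∏ k (f x)) * ∏ k (λ y → ∏ h (λ x → g x y))
    ≡⟨ cong (∏ h (λ x → ∏ k (f x)) *_) (∏-comm k h (λ y x → g x y)) ⟩
  ∏ h (λ x → ∏ k (f x)) * ∏ h (λ x → ∏ k (g x))
    ≡⟨ ∏-distrib-* h (λ x → ∏ k (f x)) (λ x → ∏ k (g x)) ⟨
  ∏ h (λ x → ∏ k (f x) * ∏ k (g x))
    ≡⟨ ∏-cong h (λ x x<h → trans (sym (∏-distrib-* k (f x) (g x)))
         (∏-cong k (λ y _ → above*above h k (odd h ℕ.* suc y) (odd k ℕ.* suc x) (multiples≢ P Q h≢k x y x<h)))) ⟩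
  ∏ h row
    ≡⟨ ∏-palindrome j row row-reflect ⟩
  ∏ j row * ∏ j row
    ≡⟨ ±1-square (∏-±1 j row (λ x → ∏-±1 k (e x) (λ y → ε-values (near? h k (odd h ℕ.* suc y) (odd k ℕ.* suc x))))) ⟩
  1ℤ ∎
  where
  open ≡-Reasoning
  h : ℕ
  h = j ℕ.+ j
  f g e : ℕ → ℕ → ℤ
  f x y = ε (above? h (odd h ℕ.* suc y) (odd k ℕ.* suc x))
  g x y = ε (above? k (odd k ℕ.* suc x) (odd h ℕ.* suc y))
  e x y = ε (near? h k (odd h ℕ.* suc y) (odd k ℕ.* suc x))
  row : ℕ → ℤ
  row x = ∏ k (e x)
  row-reflect : ∀ x → x ℕ.< h → row (h ℕ.∸ suc x) ≡ row x
  row-reflect x x<h = trans (∏-reverse k (e (h ℕ.∸ suc x))) (∏-cong k (λ y y<k →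
    let A = odd h ℕ.* suc y
        A′ = odd h ℕ.* suc (k ℕ.∸ suc y)
        B = odd k ℕ.* suc x
        B′ = odd k ℕ.* suc (h ℕ.∸ suc x)
        eq = reflect-sum h k x y x<h y<k
    in ε-cong (near? h k A′ B′) (near? h k A B)
         (near-reflect h k (trans (cong (ℕ._+ k) (ℕP.+-comm A′ A)) (trans eq (cong (ℕ._+ h) (ℕP.+-comm B B′)))))
         (near-reflect h k eq)))

trit-*≡1⇒≡ : ∀ {x y} → Trit x → Trit y → x * y ≡ 1ℤ → x ≡ y
trit-*≡1⇒≡ (inj₁ refl) _ ()
trit-*≡1⇒≡ {x} (inj₂ _) (inj₁ refl) e = contradiction (trans (sym (ℤP.*-zeroʳ x)) e) (λ ())
trit-*≡1⇒≡ (inj₂ (inj₁ refl)) (inj₂ (inj₁ refl)) _ = refl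
trit-*≡1⇒≡ (inj₂ (inj₂ refl)) (inj₂ (inj₂ refl)) _ = refl
trit-*≡1⇒≡ (inj₂ (inj₁ refl)) (inj₂ (inj₂ refl)) ()
trit-*≡1⇒≡ (inj₂ (inj₂ refl)) (inj₂ (inj₁ refl)) ()

reciprocity : ∀ j {k} → OddPrime (j ℕ.+ j) → OddPrime k →
  legendre (+ odd k) (odd (j ℕ.+ j)) ≡ legendre (+ odd (j ℕ.+ j)) (odd k)
reciprocity j {k} P Q with j ℕ.+ j ℕ.≟ k
... | yes refl = refl
... | no h≢k = trit-*≡1⇒≡ (legendre-trit (+ odd k) (odd (j ℕ.+ j))) (legendre-trit (+ odd (j ℕ.+ j)) (odd k))
  (reciprocity-≢ j P Q h≢k)

-- The Jacobi symbol as a product of Legendre symbols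

-- The fuelled recursions behind spfOff and jacobi are private; the metavariables
-- below are solved to them by unification with one unfolding of the public functions.
mutual
  searchFrom : ℕ → ℕ → ℕ → ℕ
  searchFrom = _

  spfOff-step : ∀ n → ¬ 2 ℕD.∣ suc n → spfOff (suc n) ≡ searchFrom n 1 (suc n)
  spfOff-step n 2∤n with 2 ℕD.∣? suc n
  ... | yes 2∣n = contradiction 2∣n 2∤n
  -- Abstracting the arguments leaves the metavariable applied to distinct variables, a pattern that
  -- unification can solve.
  ... | no _ with suc n | 1
  ...   | _ | _ = refl

mutual
  jacobiFuel : ℕ → ℤ → ℕ → ℤ
  jacobiFuel = _

  jacobi-step : ∀ x n → jacobi x (2 ℕ.+ n) ≡
    legendre x (2 ℕ.+ spfOff (2 ℕ.+ n)) * jacobiFuel (suc n) x ((2 ℕ.+ n) ℕ./ (2 ℕ.+ spfOff (2 ℕ.+ n)))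
  jacobi-step x n with spfOff (2 ℕ.+ n)
  ... | d with (2 ℕ.+ n) ℕ./ (2 ℕ.+ d)
  ...   | _ with suc n
  ...     | _ = refl

-- Throughout the search m has no divisor d with 1 < d < 2 + j, so the first divisor found is prime.
-- When the fuel is gone j = m, and this would exclude m itself.
searchFrom-prime : ∀ f j m → j ℕ.+ f ≡ m → 2 ℕ.≤ m → (2 ℕ.+ j) Rough m →
  2 ℕ.+ searchFrom f j m ℕD.∣ m × Prime (2 ℕ.+ searchFrom f j m)
searchFrom-prime zero j m j+0≡m 2≤m rough = contradiction
  (rough⇒≤ {{ℕ.n>1⇒nonTrivial 2≤m}} rough)
  (ℕP.<⇒≱ (ℕ.s≤s (ℕP.m≤n⇒m≤1+n (ℕP.≤-reflexive (trans (sym j+0≡m) (ℕP.+-identityʳ j))))))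
searchFrom-prime (suc f) j m j+f≡m 2≤m rough with 2 ℕ.+ j ℕD.∣? m
... | yes d∣m = d∣m , rough∧∣⇒prime rough d∣m
... | no d∤m = searchFrom-prime f (suc j) m (trans (sym (ℕP.+-suc j f)) j+f≡m) 2≤m (∤⇒rough-suc d∤m rough)

spf : ℕ → ℕ
spf m = 2 ℕ.+ spfOff m

spf-prime : ∀ m → 2 ℕ.≤ m → spf m ℕD.∣ m × Prime (spf m)
spf-prime m 2≤m = searchFrom-prime m 0 m refl 2≤m 2-rough

legendres : ℤ → List ℕ → ℤ
legendres x = foldr (λ l s → legendre x l * s) 1ℤ

-- The factors split off do not depend on x, so one list serves all numerators. Each division at
-- least halves m, hence fuel m is enough.
jacobiFuel-factors : ∀ f m → m ℕ.≤ f → 1 ℕ.≤ m →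
  ∃ λ ls → All Prime ls × product ls ≡ m × (∀ x → jacobiFuel f x m ≡ legendres x ls)
jacobiFuel-factors (suc f) 1 _ _ = [] , [] , refl , λ _ → refl
jacobiFuel-factors (suc f) m@(suc (suc n)) m≤f _ =
  let d∣m , d-prime = spf-prime m (ℕ.s≤s (ℕ.s≤s ℕ.z≤n))
      q*d≡m = ℕDM.m/n*n≡m d∣m
      q<m = ℕDM.m/n<m m (spf m) (ℕ.s≤s (ℕ.s≤s ℕ.z≤n))
      ls , ls-prime , ∏ls≡q , eq = jacobiFuel-factors f (m ℕ./ spf m)
        (ℕ.s≤s⁻¹ (ℕP.<-≤-trans q<m m≤f)) (ℕDM.m≥n⇒m/n>0 (ℕD.∣⇒≤ d∣m))
  in spf m ∷ ls , d-prime ∷ ls-prime ,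
     trans (cong (spf m ℕ.*_) ∏ls≡q) (trans (ℕP.*-comm (spf m) (m ℕ./ spf m)) q*d≡m) ,
     λ x → cong (legendre x (spf m) *_) (eq x)

jacobi-factors : ∀ m → 1 ℕ.≤ m →
  ∃ λ ls → All Prime ls × product ls ≡ m × (∀ x → jacobi x m ≡ legendres x ls)
jacobi-factors m = jacobiFuel-factors m m ℕP.≤-refl

-- Reciprocity for p = c² + d² and 16 a² + 1

parity : ∀ n → (∃ λ j → n ≡ j ℕ.+ j) ⊎ (∃ λ j → n ≡ odd j)
parity zero = inj₁ (0 , refl)
parity (suc n) = Sum.[ (λ (j , e) → inj₂ (j , cong suc e))
                     , (λ (j , e) → inj₁ (suc j , cong suc (trans e (sym (ℕP.+-suc j j))))) ]′ (parity n)

2∣j+j : ∀ j → 2 ℕD.∣ j ℕ.+ j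
2∣j+j j = ℕD.divides j (trans (cong (j ℕ.+_) (sym (ℕP.+-identityʳ j))) (ℕP.*-comm 2 j))

2∤odd : ∀ h → ¬ 2 ℕD.∣ odd h
2∤odd h 2∣p = contradiction (ℕD.∣⇒≤ (ℕD.∣m+n∣m⇒∣n (subst (2 ℕD.∣_) (ℕP.+-comm 1 (h ℕ.+ h)) 2∣p) (2∣j+j h))) (λ { (ℕ.s≤s ()) })

-- Indexed by the number itself, so that matching replaces it by `odd h` throughout the goal;
-- likewise for `IsPrime1mod4`.
data IsOddPrime : ℕ → Set where
  isOddPrime : ∀ {h} → OddPrime h → IsOddPrime (odd h)

data IsPrime1mod4 : ℕ → Set where
  isPrime1mod4 : ∀ j → OddPrime (j ℕ.+ j) → IsPrime1mod4 (odd (j ℕ.+ j))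

prime⇒oddPrime : ∀ {q} → Prime q → ¬ 2 ℕD.∣ q → IsOddPrime q
prime⇒oddPrime {q} q-prime 2∤q = Sum.[ even , odd-case ]′ (parity q)
  where
  even : (∃ λ j → q ≡ j ℕ.+ j) → IsOddPrime q
  even (j , refl) = contradiction (2∣j+j j) 2∤q
  odd-case : (∃ λ j → q ≡ odd j) → IsOddPrime q
  odd-case (j , refl) = isOddPrime {j} (oddPrime q-prime)

^-neg-even : ∀ x j → (- x) ^ (j ℕ.+ j) ≡ x ^ (j ℕ.+ j)
^-neg-even x j = begin
  (- x) ^ (j ℕ.+ j)     ≡⟨ ℤP.^-distribˡ-+-* (- x) j j ⟩
  (- x) ^ j * (- x) ^ j ≡⟨ *-^-distrib (- x) (- x) j ⟨
  ((- x) * (- x)) ^ j   ≡⟨ cong (_^ j) (lemma x) ⟩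
  (x * x) ^ j           ≡⟨ *-^-distrib x x j ⟩
  x ^ j * x ^ j         ≡⟨ ℤP.^-distribˡ-+-* x j j ⟨
  x ^ (j ℕ.+ j)         ∎
  where
  open ≡-Reasoning
  lemma : ∀ x → (- x) * (- x) ≡ x * x
  lemma = solve-∀

-- From y² = -1 follows (-1)^h = y^(2h) = 1. For odd h this reads -1 = 1, impossible modulo an odd
-- prime.
-1-square⇒even : ∀ {h} → OddPrime h → ∀ y → y * y ≅ -1ℤ [ odd h ] → ∃ λ j → h ≡ j ℕ.+ j
-1-square⇒even {h} P y y²≅-1 = Sum.[ (λ c → c) , impossible ]′ (parity h)
  where
  -1≇0 : ¬ -1ℤ ≅ 0ℤ [ odd h ]
  -1≇0 = 1≇0 P ∘ -‿cong
  y≇0 : ¬ y ≅ 0ℤ [ odd h ]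
  y≇0 y≅0 = -1≇0 (≅-trans (≅-sym y²≅-1) (*-cong y≅0 y≅0))
  -1^h≅1 : -1ℤ ^ h ≅ 1ℤ [ odd h ]
  -1^h≅1 = ≅-trans (^-cong h (≅-sym y²≅-1)) (square-^ P y y≇0)
  impossible : (∃ λ j → h ≡ odd j) → ∃ λ j → h ≡ j ℕ.+ j
  impossible (j , h≡) = contradiction (≅-sym (+-cong (≅-sym -1≅1) (≅-refl {x = 1ℤ}))) (2≇0 P ∘ ≅-sym)
    where
    -1^h≡-1 : -1ℤ ^ h ≡ -1ℤ
    -1^h≡-1 = trans (cong (-1ℤ ^_) h≡) (cong (-1ℤ *_) (trans (^-neg-even 1ℤ j) (ℤP.^-zeroˡ (j ℕ.+ j))))
    -1≅1 : -1ℤ ≅ 1ℤ [ odd h ]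
    -1≅1 = ≅-trans (≡⇒≅ (sym -1^h≡-1)) -1^h≅1

legendre-neg : ∀ j → OddPrime (j ℕ.+ j) → ∀ x → legendre (- x) (odd (j ℕ.+ j)) ≡ legendre x (odd (j ℕ.+ j))
legendre-neg j P x = legendre-unique P (- x) (legendre-trit x (odd (j ℕ.+ j)))
  (≅-trans (euler P x) (≡⇒≅ (sym (^-neg-even x j))))

module _ (t : ℕ) (P : OddPrime (t ℕ.+ t)) where

  private
    p : ℕ
    p = odd (t ℕ.+ t)

  -- The exponent h is even and loses the sign. This allows |e|, which has a prime factorisation, to
  -- replace e.
  legendre-abs : ∀ x → legendre (+ ∣ x ∣) p ≡ legendre x p
  legendre-abs (+ n) = refl
  legendre-abs -[1+ n ] = sym (legendre-neg t P (+ suc n))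

legendres-1 : ∀ {ls} → All IsPrime1mod4 ls → legendres 1ℤ ls ≡ 1ℤ
legendres-1 [] = refl
legendres-1 (isPrime1mod4 j L ∷ Ls) = cong₂ _*_ (legendre-1 L) (legendres-1 Ls)

legendres-* : ∀ {ls} → All IsPrime1mod4 ls → ∀ x y → legendres (x * y) ls ≡ legendres x ls * legendres y ls
legendres-* [] x y = refl
legendres-* {l ∷ ls} (isPrime1mod4 j L ∷ Ls) x y = trans (cong₂ _*_ (legendre-* L x y) (legendres-* Ls x y))
  (interchange (legendre x l) (legendre y l) (legendres x ls) (legendres y ls))
  where
  interchange : ∀ a b c d → a * b * (c * d) ≡ a * c * (b * d)
  interchange = solve-∀

legendres-abs : ∀ {ls} → All IsPrime1mod4 ls → ∀ x → legendres (+ ∣ x ∣) ls ≡ legendres x ls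
legendres-abs [] x = refl
legendres-abs (isPrime1mod4 j L ∷ Ls) x = cong₂ _*_ (legendre-abs j L x) (legendres-abs Ls x)

legendres-reciprocity : ∀ {ls k} → All IsPrime1mod4 ls → OddPrime k →
  legendre (+ product ls) (odd k) ≡ legendres (+ odd k) ls
legendres-reciprocity [] Q = legendre-1 Q
legendres-reciprocity {l ∷ ls} {k} (isPrime1mod4 j L ∷ Ls) Q = begin
  legendre (+ (l ℕ.* product ls)) (odd k)               ≡⟨ cong (λ x → legendre x (odd k)) (ℤP.pos-* l (product ls)) ⟩
  legendre (+ l * + product ls) (odd k)                 ≡⟨ legendre-* Q (+ l) (+ product ls) ⟩
  legendre (+ l) (odd k) * legendre (+ product ls) (odd k) ≡⟨ cong₂ _*_ (sym (reciprocity j L Q)) (legendres-reciprocity Ls Q) ⟩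
  legendre (+ odd k) l * legendres (+ odd k) ls         ∎
  where open ≡-Reasoning

square≡pos : ∀ a → a * a ≡ + (∣ a ∣ ℕ.* ∣ a ∣)
square≡pos (+ n) = sym (ℤP.pos-* n n)
square≡pos -[1+ n ] = refl

module _ (a : ℤ) where

  M : ℕ
  M = ∣ + 16 * a * a + 1ℤ ∣

  +M≡ : + M ≡ + 16 * a * a + 1ℤ
  +M≡ = trans (cong (+_ ∘ ∣_∣) eq) (sym eq)
    where
    n : ℕ
    n = ∣ a ∣ ℕ.* ∣ a ∣
    eq : + 16 * a * a + 1ℤ ≡ + (16 ℕ.* n ℕ.+ 1)
    eq = begin
      + 16 * a * a + 1ℤ       ≡⟨ cong (_+ 1ℤ) (ℤP.*-assoc (+ 16) a a) ⟩
      + 16 * (a * a) + 1ℤ     ≡⟨ cong (λ z → + 16 * z + 1ℤ) (square≡pos a) ⟩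
      + 16 * + n + 1ℤ         ≡⟨ cong (_+ 1ℤ) (ℤP.pos-* 16 n) ⟨
      + (16 ℕ.* n) + 1ℤ       ≡⟨ ℤP.pos-+ (16 ℕ.* n) 1 ⟨
      + (16 ℕ.* n ℕ.+ 1)      ∎
      where open ≡-Reasoning

  2∤M : ¬ 2 ℕD.∣ M
  2∤M 2∣M = contradiction (ℕD.∣⇒≤ (≅0⇒∣ 1≅0)) (λ { (ℕ.s≤s ()) })
    where
    split : ∀ a → 1ℤ ≡ + 16 * a * a + 1ℤ + (- (+ 8 * a * a)) * + 2
    split = solve-∀
    1≅0 : 1ℤ ≅ 0ℤ [ 2 ]
    1≅0 = ≅-trans (≅-witness {y = + 16 * a * a + 1ℤ} (- (+ 8 * a * a)) (split a)) (∣⇒≅0 {x = + 16 * a * a + 1ℤ} 2∣M)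

  -- Modulo l the number 4a is a square root of -1.
  M-prime-factor : ∀ {l} → Prime l → l ℕD.∣ M → IsPrime1mod4 l
  M-prime-factor l-prime l∣M = 1mod4 (prime⇒oddPrime l-prime (λ 2∣l → 2∤M (ℕD.∣-trans 2∣l l∣M))) l∣M
    where
    split : ∀ a → + 4 * a * (+ 4 * a) ≡ + 16 * a * a + 1ℤ - 1ℤ
    split = solve-∀
    1mod4 : ∀ {l} → IsOddPrime l → l ℕD.∣ M → IsPrime1mod4 l
    1mod4 (isOddPrime L) l∣M = even (-1-square⇒even L (+ 4 * a)
        (≅-trans (≡⇒≅ (split a)) (+-cong (∣⇒≅0 {x = + 16 * a * a + 1ℤ} l∣M) (≅-refl {x = -1ℤ})))) L
      where
      even : ∀ {h} → (∃ λ j → h ≡ j ℕ.+ j) → OddPrime h → IsPrime1mod4 (odd h)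
      even (j , refl) L = isPrime1mod4 j L

  M-prime-factors : ∀ ls → All Prime ls → product ls ℕD.∣ M → All IsPrime1mod4 ls
  M-prime-factors [] [] _ = []
  M-prime-factors (l ∷ ls) (l-prime ∷ ls-prime) ∏∣M =
    M-prime-factor l-prime (ℕD.∣-trans (ℕD.m∣m*n (product ls)) ∏∣M) ∷
    M-prime-factors ls ls-prime (ℕD.∣-trans (ℕD.n∣m*n l) ∏∣M)

module _ {p : ℕ} (pp : Prime p) (c d : ℤ) (p≡ : + p ≡ c * c + d * d) where

  -- A common prime factor q would give q² dividing the prime p.
  coprime : ∀ {q} → Prime q → c ≅ 0ℤ [ q ] → d ≅ 0ℤ [ q ] → ⊥
  coprime {q} q-prime c≅0 d≅0 = Sum.[ (λ q≡1 → ¬prime[1] (subst Prime q≡1 q-prime)) , q≢p ]′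
      (prime⇒irreducible pp (ℕD.∣-trans (ℕD.m∣m*n q) q²∣p))
    where
    i = proj₁ (≅-quotient c≅0)
    j = proj₁ (≅-quotient d≅0)
    regroup : ∀ i j q → (0ℤ + i * q) * (0ℤ + i * q) + (0ℤ + j * q) * (0ℤ + j * q) ≡ 0ℤ + (i * i + j * j) * (q * q)
    regroup = solve-∀
    q²∣p : q ℕ.* q ℕD.∣ p
    q²∣p = ≅0⇒∣ (≅-witness {x = + p} (i * i + j * j) (trans p≡
      (trans (cong₂ (λ c d → c * c + d * d) (proj₂ (≅-quotient c≅0)) (proj₂ (≅-quotient d≅0)))
        (trans (regroup i j (+ q)) (cong (λ z → 0ℤ + (i * i + j * j) * z) (sym (ℤP.pos-* q q)))))))
    q≢p : ¬ q ≡ p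
    q≢p refl = contradiction (ℕD.∣⇒≤ {{prime⇒nonZero q-prime}} q²∣p)
      (ℕP.<⇒≱ (ℕP.m<m*n q q {{prime⇒nonZero q-prime}} (ℕ.nonTrivial⇒n>1 q {{prime⇒nonTrivial q-prime}})))

module TwoSquares (t : ℕ) (P : OddPrime (t ℕ.+ t)) (c d : ℤ) (p≡ : + odd (t ℕ.+ t) ≡ c * c + d * d) (2∣d : (+ 2) ∣ d) where

  p : ℕ
  p = odd (t ℕ.+ t)

  module _ (a : ℤ) where

    private
      e : ℤ
      e = c - + 4 * a * d

    -- Since d is even, e has the parity of c. Were both c and d even, p would be even.
    2∤e : ¬ 2 ℕD.∣ ∣ e ∣
    2∤e 2∣e = 2∤odd (t ℕ.+ t) (≅0⇒∣ (≅-trans (≡⇒≅ p≡) (+-cong (*-cong c≅0 c≅0) (*-cong d≅0 d≅0))))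
      where
      d≅0 : d ≅ 0ℤ [ 2 ]
      d≅0 = ∣⇒≅0 2∣d
      c≅0 : c ≅ 0ℤ [ 2 ]
      c≅0 = ≅-trans (-≅0⇒≅ {x = c} {y = + 4 * a * d} (∣⇒≅0 {x = e} 2∣e)) (≅-trans (*-congˡ (+ 4 * a) d≅0) (≡⇒≅ (ℤP.*-zeroʳ (+ 4 * a))))

    prime-factor : ∀ {k ls} → OddPrime k → odd k ℕD.∣ ∣ e ∣ → All IsPrime1mod4 ls → product ls ≡ M a →
      legendre (+ odd k) p ≡ legendres (+ odd k) ls
    prime-factor {k} {ls} Q q∣e Ls ∏ls≡M = begin
      legendre (+ odd k) p                           ≡⟨ reciprocity t P Q ⟩
      legendre (+ p) (odd k)                         ≡⟨ legendre-cong Q p≅d²M ⟩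
      legendre (d * d * + M a) (odd k)               ≡⟨ legendre-* Q (d * d) (+ M a) ⟩
      legendre (d * d) (odd k) * legendre (+ M a) (odd k)
        ≡⟨ cong₂ _*_ (legendre-square Q d d≇0) (cong (λ n → legendre (+ n) (odd k)) (sym ∏ls≡M)) ⟩
      1ℤ * legendre (+ product ls) (odd k)           ≡⟨ ℤP.*-identityˡ _ ⟩
      legendre (+ product ls) (odd k)                ≡⟨ legendres-reciprocity Ls Q ⟩
      legendres (+ odd k) ls                         ∎
      where
      open ≡-Reasoning
      c≅4ad : c ≅ + 4 * a * d [ odd k ]
      c≅4ad = -≅0⇒≅ {x = c} {y = + 4 * a * d} (∣⇒≅0 {x = e} q∣e)
      -- If q divided d, it would divide c ≡ 4ad too. Hence d² is a nonzero square and drops out of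
      -- the symbol.
      d≇0 : ¬ d ≅ 0ℤ [ odd k ]
      d≇0 d≅0 = coprime (isPrime P) c d p≡ (isPrime Q)
        (≅-trans c≅4ad (≅-trans (*-congˡ (+ 4 * a) d≅0) (≡⇒≅ (ℤP.*-zeroʳ (+ 4 * a))))) d≅0
      regroup : ∀ a d → + 4 * a * d * (+ 4 * a * d) + d * d ≡ d * d * (+ 16 * a * a + 1ℤ)
      regroup = solve-∀
      p≅d²M : + p ≅ d * d * + M a [ odd k ]
      p≅d²M = ≅-trans (≡⇒≅ p≡) (≅-trans (+-cong (*-cong c≅4ad c≅4ad) (≅-refl {x = d * d}))
        (≡⇒≅ (trans (regroup a d) (cong (d * d *_) (sym (+M≡ a))))))

    prime-factors : ∀ {ls} → All IsPrime1mod4 ls → product ls ≡ M a →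
      ∀ qs → All Prime qs → product qs ℕD.∣ ∣ e ∣ → legendre (+ product qs) p ≡ legendres (+ product qs) ls
    prime-factors Ls ∏ls≡M [] [] _ = trans (legendre-1 P) (sym (legendres-1 Ls))
    prime-factors {ls} Ls ∏ls≡M (q ∷ qs) (q-prime ∷ qs-prime) ∏∣e =
      trans (cong (λ x → legendre x p) (ℤP.pos-* q (product qs)))
        (trans (legendre-* P (+ q) (+ product qs))
          (trans (cong₂ _*_ (first (prime⇒oddPrime q-prime (λ 2∣q → 2∤e (ℕD.∣-trans 2∣q q∣e))) q∣e)
                            (prime-factors Ls ∏ls≡M qs qs-prime (ℕD.∣-trans (ℕD.n∣m*n q) ∏∣e)))
            (trans (sym (legendres-* Ls (+ q) (+ product qs)))
                   (cong (λ x → legendres x ls) (sym (ℤP.pos-* q (product qs)))))))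
      where
      q∣e : q ℕD.∣ ∣ e ∣
      q∣e = ℕD.∣-trans (ℕD.m∣m*n (product qs)) ∏∣e
      first : ∀ {q} → IsOddPrime q → q ℕD.∣ ∣ e ∣ → legendre (+ q) p ≡ legendres (+ q) ls
      first (isOddPrime Q) q∣e = prime-factor Q q∣e Ls ∏ls≡M

    legendre≡jacobi : legendre e p ≡ jacobi e (M a)
    legendre≡jacobi =
      let ls , ls-prime , ∏ls≡M , jacobi≡ = jacobi-factors (M a) (ℕP.n≢0⇒n>0 (λ M≡0 → 2∤M a (subst (2 ℕD.∣_) (sym M≡0) (ℕD._∣0 2))))
          Ls = M-prime-factors a ls ls-prime (ℕD.∣-reflexive ∏ls≡M)
          instance e≢0 = ℕ.≢-nonZero (λ e≡0 → 2∤e (subst (2 ℕD.∣_) (sym e≡0) (ℕD._∣0 2)))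
          fs = factorise ∣ e ∣
          open PrimeFactorisation fs
      in trans (sym (legendre-abs t P e))
           (trans (subst (λ n → legendre (+ n) p ≡ legendres (+ n) ls) (sym isFactorisation)
                     (prime-factors Ls ∏ls≡M factors factorsPrime (ℕD.∣-reflexive (sym isFactorisation))))
             (trans (legendres-abs Ls e) (sym (jacobi≡ e))))

-- Binomial coefficients

binom : ℕ → ℕ → ℤ
binom n k = + (n C k)

pascal : ∀ n k → binom (suc n) (suc k) ≡ binom n k + binom n (suc k)
pascal n k = cong +_ (sym (nCk+nC[k+1]≡[n+1]C[k+1] n k))

C-zero : ∀ n → n C 0 ≡ 1
C-zero zero = refl
C-zero (suc n) = refl

absorption : ∀ n k → + suc k * binom (suc n) (suc k) ≡ + suc n * binom n k
absorption zero zero = refl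
absorption zero (suc k) = trans (cong (λ m → + (2 ℕ.+ k) * + m) (k>n⇒nCk≡0 {1} {2 ℕ.+ k} (ℕ.s≤s (ℕ.s≤s ℕ.z≤n))))
  (trans (ℤP.*-zeroʳ (+ (2 ℕ.+ k))) (cong (λ m → 1ℤ * + m) (sym (k>n⇒nCk≡0 {0} {suc k} (ℕ.s≤s ℕ.z≤n)))))
absorption (suc n) zero = trans (ℤP.*-identityˡ _) (trans (cong +_ (nC1≡n (2 ℕ.+ n)))
  (trans (sym (ℤP.*-identityʳ _)) (cong (λ m → + (2 ℕ.+ n) * + m) (sym (C-zero (suc n))))))
absorption (suc n) (suc k) = begin
  + (2 ℕ.+ k) * binom (2 ℕ.+ n) (2 ℕ.+ k)
    ≡⟨ cong (+ (2 ℕ.+ k) *_) (pascal (suc n) (suc k)) ⟩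
  + (2 ℕ.+ k) * (u + v)
    ≡⟨ split (+ suc k) u v ⟩
  + suc k * u + u + + (2 ℕ.+ k) * v
    ≡⟨ cong₂ (λ x y → x + u + y) (absorption n k) (absorption n (suc k)) ⟩
  + suc n * binom n k + u + + suc n * binom n (suc k)
    ≡⟨ join (+ suc n) (binom n k) (binom n (suc k)) u ⟩
  + suc n * (binom n k + binom n (suc k)) + u
    ≡⟨ cong (λ x → + suc n * x + u) (pascal n k) ⟨
  + suc n * u + u
    ≡⟨ collect (+ suc n) u ⟩
  + (2 ℕ.+ n) * u ∎
  where
  open ≡-Reasoning
  u v : ℤ
  u = binom (suc n) (suc k)
  v = binom (suc n) (2 ℕ.+ k)
  split : ∀ k u v → (1ℤ + k) * (u + v) ≡ k * u + u + (1ℤ + k) * v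
  split = solve-∀
  join : ∀ n x y u → n * x + u + n * y ≡ n * (x + y) + u
  join = solve-∀
  collect : ∀ n u → n * u + u ≡ (1ℤ + n) * u
  collect = solve-∀

-- Stated over the integers, where n - k may be negative; the coefficient is then 0 and the ratio
-- still holds.
binom-suc : ∀ n k → + suc k * binom n (suc k) ≡ (+ n - + k) * binom n k
binom-suc n k = begin
  + suc k * v                          ≡⟨ isolate (+ suc k) u v ⟩
  + suc k * (u + v) - + suc k * u      ≡⟨ cong (λ x → + suc k * x - + suc k * u) (pascal n k) ⟨
  + suc k * binom (suc n) (suc k) - + suc k * u ≡⟨ cong (_- + suc k * u) (absorption n k) ⟩
  + suc n * u - + suc k * u            ≡⟨ subtract (+ n) (+ k) u ⟩
  (+ n - + k) * u                      ∎
  where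
  open ≡-Reasoning
  u v : ℤ
  u = binom n k
  v = binom n (suc k)
  isolate : ∀ k u v → k * v ≡ k * (u + v) - k * u
  isolate = solve-∀
  subtract : ∀ n k u → (1ℤ + n) * u - (1ℤ + k) * u ≡ (n - k) * u
  subtract = solve-∀

central-suc : ∀ n → + suc n * binom (suc n ℕ.+ suc n) (suc n) ≡ + 2 * + suc (n ℕ.+ n) * binom (n ℕ.+ n) n
central-suc n = begin
  + suc n * binom (suc n ℕ.+ suc n) (suc n) ≡⟨ cong (λ m → + suc n * binom (suc m) (suc n)) (ℕP.+-suc n n) ⟩
  + suc n * binom (2 ℕ.+ (n ℕ.+ n)) (suc n) ≡⟨ absorption (suc (n ℕ.+ n)) n ⟩
  + (2 ℕ.+ (n ℕ.+ n)) * u                   ≡⟨ cong (_* u) (cong (λ z → + 2 + z) (ℤP.pos-+ n n)) ⟩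
  (+ 2 + (+ n + + n)) * u                   ≡⟨ halve (+ n) u ⟩
  + 2 * ((1ℤ + + n + + n - + n) * u)        ≡⟨ cong (λ z → + 2 * ((z - + n) * u)) (ℤP.pos-+ (suc n) n) ⟨
  + 2 * ((+ suc (n ℕ.+ n) - + n) * u)       ≡⟨ cong (+ 2 *_) (binom-suc (suc (n ℕ.+ n)) n) ⟨
  + 2 * (+ suc n * binom (suc (n ℕ.+ n)) (suc n)) ≡⟨ cong (+ 2 *_) (absorption (n ℕ.+ n) n) ⟩
  + 2 * (+ suc (n ℕ.+ n) * binom (n ℕ.+ n) n) ≡⟨ ℤP.*-assoc (+ 2) (+ suc (n ℕ.+ n)) _ ⟨
  + 2 * + suc (n ℕ.+ n) * binom (n ℕ.+ n) n ∎
  where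
  open ≡-Reasoning
  u : ℤ
  u = binom (suc (n ℕ.+ n)) n
  halve : ∀ n u → (+ 2 + (n + n)) * u ≡ + 2 * ((1ℤ + n + n - n) * u)
  halve = solve-∀

-- Since h = -1/2 modulo p, this is C(2n, n) = (-4)^n C(-1/2, n).
central-≅ : ∀ {h} → OddPrime h → ∀ n → n ℕ.≤ h → binom (n ℕ.+ n) n ≅ (- + 4) ^ n * binom h n [ odd h ]
central-≅ {h} P zero _ = ≡⇒≅ (trans (cong +_ (sym (C-zero h))) (sym (ℤP.*-identityˡ (binom h 0))))
central-≅ {h} P (suc n) n<h = *-cancelˡ (isPrime P) (+ suc n) (suc≇0 P n n<h) (begin
  + suc n * binom (suc n ℕ.+ suc n) (suc n)                  ≡⟨ central-suc n ⟩
  + 2 * + suc (n ℕ.+ n) * binom (n ℕ.+ n) n                  ≈⟨ *-congˡ (+ 2 * + suc (n ℕ.+ n)) (central-≅ P n (ℕP.<⇒≤ n<h)) ⟩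
  + 2 * + suc (n ℕ.+ n) * (w * b)                            ≡⟨ cong (λ z → + 2 * z * (w * b)) (ℤP.pos-+ (suc n) n) ⟩
  -- The numbers 2(2n + 1) and -4(h - n) differ by 2(2h + 1) = 2p.
  + 2 * (1ℤ + + n + + n) * (w * b)                           ≈⟨ ≅-witness {y = - + 4 * w * ((+ h - + n) * b)} (+ 2 * (w * b)) reduce ⟩
  - + 4 * w * ((+ h - + n) * b)                              ≡⟨ cong (- + 4 * w *_) (binom-suc h n) ⟨
  - + 4 * w * (+ suc n * binom h (suc n))                    ≡⟨ swap (- + 4 * w) (+ suc n) (binom h (suc n)) ⟩
  + suc n * (- + 4 * w * binom h (suc n))                    ∎)
  where
  open SetoidReasoning (≅-setoid (odd h))
  w b : ℤ
  w = (- + 4) ^ n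
  b = binom h n
  swap : ∀ x y z → x * (y * z) ≡ y * (x * z)
  swap = solve-∀
  identity : ∀ h n w b → + 2 * (1ℤ + n + n) * (w * b) ≡ - + 4 * w * ((h - n) * b) + + 2 * (w * b) * (1ℤ + h + h)
  identity = solve-∀
  reduce : + 2 * (1ℤ + + n + + n) * (w * b) ≡ - + 4 * w * ((+ h - + n) * b) + + 2 * (w * b) * + odd h
  reduce = trans (identity (+ h) (+ n) w b) (cong (λ z → - + 4 * w * ((+ h - + n) * b) + + 2 * (w * b) * z) (sym (ℤP.pos-+ (suc h) h)))

-- Finite sums

sumTo-cong-≅ : ∀ {m} n {f g} → (∀ k → k ℕ.≤ n → f k ≅ g k [ m ]) → sumTo n f ≅ sumTo n g [ m ]
sumTo-cong-≅ zero f≅g = f≅g 0 ℕ.z≤n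
sumTo-cong-≅ (suc n) f≅g = +-cong (sumTo-cong-≅ n (λ k k≤n → f≅g k (ℕP.m≤n⇒m≤1+n k≤n))) (f≅g (suc n) ℕP.≤-refl)

sumTo-+ : ∀ n f g → sumTo n f + sumTo n g ≡ sumTo n (λ k → f k + g k)
sumTo-+ zero f g = refl
sumTo-+ (suc n) f g = trans (interchange (sumTo n f) (f (suc n)) (sumTo n g) (g (suc n)))
  (cong (_+ (f (suc n) + g (suc n))) (sumTo-+ n f g))
  where
  interchange : ∀ a b c d → a + b + (c + d) ≡ a + c + (b + d)
  interchange = solve-∀

sumTo-* : ∀ n c f → c * sumTo n f ≡ sumTo n (λ k → c * f k)
sumTo-* zero c f = refl
sumTo-* (suc n) c f = trans (ℤP.*-distribˡ-+ c (sumTo n f) (f (suc n))) (cong (_+ c * f (suc n)) (sumTo-* n c f))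

sumTo-blocks : ∀ K f → sumTo (3 ℕ.+ K ℕ.* 4) f ≡
  sumTo K (λ k → f (k ℕ.* 4) + f (1 ℕ.+ k ℕ.* 4) + f (2 ℕ.+ k ℕ.* 4) + f (3 ℕ.+ k ℕ.* 4))
sumTo-blocks zero f = refl
sumTo-blocks (suc K) f = trans
  (assoc (sumTo (3 ℕ.+ K ℕ.* 4) f) (f (4 ℕ.+ K ℕ.* 4)) (f (5 ℕ.+ K ℕ.* 4)) (f (6 ℕ.+ K ℕ.* 4)) (f (7 ℕ.+ K ℕ.* 4)))
  (cong (_+ (f (4 ℕ.+ K ℕ.* 4) + f (5 ℕ.+ K ℕ.* 4) + f (6 ℕ.+ K ℕ.* 4) + f (7 ℕ.+ K ℕ.* 4))) (sumTo-blocks K f))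
  where
  assoc : ∀ s a b c d → s + a + b + c + d ≡ s + (a + b + c + d)
  assoc = solve-∀

-- The binomial theorem and the terms of degree divisible by 4

binomialTerm : ℕ → ℤ → ℕ → ℤ
binomialTerm h x n = binom h n * x ^ n

pascal-sum : ∀ h N x → sumTo (suc N) (binomialTerm (suc h) x) ≡
  sumTo (suc N) (binomialTerm h x) + x * sumTo N (binomialTerm h x)
pascal-sum h zero x = begin
  binom (suc h) 0 * 1ℤ + binom (suc h) 1 * (x * 1ℤ)
    ≡⟨ cong₂ (λ u v → + u * 1ℤ + v * (x * 1ℤ)) (trans (C-zero (suc h)) (sym (C-zero h))) (pascal h 0) ⟩
  binom h 0 * 1ℤ + (binom h 0 + binom h 1) * (x * 1ℤ)
    ≡⟨ lemma (binom h 0) (binom h 1) x ⟩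
  binom h 0 * 1ℤ + binom h 1 * (x * 1ℤ) + x * (binom h 0 * 1ℤ) ∎
  where
  open ≡-Reasoning
  lemma : ∀ u v x → u * 1ℤ + (u + v) * (x * 1ℤ) ≡ u * 1ℤ + v * (x * 1ℤ) + x * (u * 1ℤ)
  lemma = solve-∀
pascal-sum h (suc N) x = trans
  (cong₂ (λ s b → s + b * (x * (x * x ^ N))) (pascal-sum h N x) (pascal h (suc N)))
  (lemma (sumTo (suc N) (binomialTerm h x)) (sumTo N (binomialTerm h x)) x (x ^ N) (binom h (suc N)) (binom h (2 ℕ.+ N)))
  where
  lemma : ∀ s r x w u v → s + x * r + (u + v) * (x * (x * w)) ≡ s + v * (x * (x * w)) + x * (r + u * (x * w))
  lemma = solve-∀

-- The sum may run beyond h, where the coefficients vanish, so it can be extended to complete blocks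
-- of four.
binomial : ∀ h N x → h ℕ.≤ N → (1ℤ + x) ^ h ≡ sumTo N (binomialTerm h x)
binomial zero zero x _ = refl
binomial zero (suc N) x _ = trans (binomial zero N x ℕ.z≤n)
  (sym (trans (cong (λ c → sumTo N (binomialTerm 0 x) + + c * x ^ suc N) (k>n⇒nCk≡0 {0} {suc N} (ℕ.s≤s ℕ.z≤n)))
    (ℤP.+-identityʳ _)))
binomial (suc h) (suc N) x (ℕ.s≤s h≤N) = begin
  (1ℤ + x) * (1ℤ + x) ^ h
    ≡⟨ ℤP.*-distribʳ-+ ((1ℤ + x) ^ h) 1ℤ x ⟩
  1ℤ * (1ℤ + x) ^ h + x * (1ℤ + x) ^ h
    ≡⟨ cong (_+ x * (1ℤ + x) ^ h) (ℤP.*-identityˡ ((1ℤ + x) ^ h)) ⟩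
  (1ℤ + x) ^ h + x * (1ℤ + x) ^ h
    ≡⟨ cong₂ (λ u v → u + x * v) (binomial h (suc N) x (ℕP.m≤n⇒m≤1+n h≤N)) (binomial h N x h≤N) ⟩
  sumTo (suc N) (binomialTerm h x) + x * sumTo N (binomialTerm h x)
    ≡⟨ pascal-sum h N x ⟨
  sumTo (suc N) (binomialTerm (suc h) x) ∎
  where open ≡-Reasoning

fourth-powers : ∀ {m} x y → x * x * (x * x) ≅ y * y * (y * y) [ m ] → ∀ k → x ^ (k ℕ.* 4) ≅ y ^ (k ℕ.* 4) [ m ]
fourth-powers x y c zero = ≅-refl
fourth-powers x y c (suc k) = ≅-trans (≡⇒≅ (lemma x (x ^ (k ℕ.* 4))))
  (≅-trans (*-cong c (fourth-powers x y c k)) (≡⇒≅ (sym (lemma y (y ^ (k ℕ.* 4))))))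
  where
  lemma : ∀ x w → x * (x * (x * (x * w))) ≡ x * x * (x * x) * w
  lemma = solve-∀

-- The four numbers ±y, ±u are the ζy with ζ⁴ = 1, so only exponents divisible by 4 survive.
quadrisection : ∀ {m} h K y u → h ℕ.≤ 3 ℕ.+ K ℕ.* 4 → u * u ≅ - (y * y) [ m ] →
  (1ℤ + y) ^ h + (1ℤ + - y) ^ h + ((1ℤ + u) ^ h + (1ℤ + - u) ^ h) ≅
  + 4 * sumTo K (λ k → binomialTerm h y (k ℕ.* 4)) [ m ]
quadrisection {m} h K y u h≤N u²≅-y² = begin
  (1ℤ + y) ^ h + (1ℤ + - y) ^ h + ((1ℤ + u) ^ h + (1ℤ + - u) ^ h)
    ≈⟨ +-cong (+-cong (expand y ≅-refl) (expand (- y) (≡⇒≅ (even y))))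
              (+-cong (expand u u⁴≅y⁴) (expand (- u) (≅-trans (≡⇒≅ (even u)) u⁴≅y⁴))) ⟩
  sumTo K (B y) + sumTo K (B (- y)) + (sumTo K (B u) + sumTo K (B (- u)))
    ≡⟨ cong₂ _+_ (sumTo-+ K (B y) (B (- y))) (sumTo-+ K (B u) (B (- u))) ⟩
  sumTo K (λ k → B y k + B (- y) k) + sumTo K (λ k → B u k + B (- u) k)
    ≡⟨ sumTo-+ K (λ k → B y k + B (- y) k) (λ k → B u k + B (- u) k) ⟩
  sumTo K (λ k → B y k + B (- y) k + (B u k + B (- u) k))
    ≈⟨ sumTo-cong-≅ K (λ k _ → collect k) ⟩
  sumTo K (λ k → + 4 * binomialTerm h y (k ℕ.* 4))
    ≡⟨ sumTo-* K (+ 4) (λ k → binomialTerm h y (k ℕ.* 4)) ⟨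
  + 4 * sumTo K (λ k → binomialTerm h y (k ℕ.* 4)) ∎
  where
  open SetoidReasoning (≅-setoid m)
  b : ℕ → ℕ → ℤ
  b i k = binom h (i ℕ.+ k ℕ.* 4)
  B : ℤ → ℕ → ℤ
  B x k = (b 0 k + b 1 k * x + b 2 k * (x * x) + b 3 k * (x * (x * x))) * y ^ (k ℕ.* 4)
  even : ∀ x → - x * - x * (- x * - x) ≡ x * x * (x * x)
  even = solve-∀
  neg-square : ∀ z → - z * - z ≡ z * z
  neg-square = solve-∀
  u⁴≅y⁴ : u * u * (u * u) ≅ y * y * (y * y) [ m ]
  u⁴≅y⁴ = ≅-trans (*-cong u²≅-y² u²≅-y²) (≡⇒≅ (neg-square (y * y)))
  factor : ∀ p q r s x w → p * w + q * (x * w) + r * (x * (x * w)) + s * (x * (x * (x * w))) ≡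
    (p + q * x + r * (x * x) + s * (x * (x * x))) * w
  factor = solve-∀
  expand : ∀ x → x * x * (x * x) ≅ y * y * (y * y) [ m ] → (1ℤ + x) ^ h ≅ sumTo K (B x) [ m ]
  expand x x⁴≅y⁴ = ≅-trans (≡⇒≅ (trans (binomial h (3 ℕ.+ K ℕ.* 4) x h≤N) (sumTo-blocks K (binomialTerm h x))))
    (sumTo-cong-≅ K (λ k _ → ≅-trans
      (≡⇒≅ (factor (b 0 k) (b 1 k) (b 2 k) (b 3 k) x (x ^ (k ℕ.* 4))))
      (*-congˡ (b 0 k + b 1 k * x + b 2 k * (x * x) + b 3 k * (x * (x * x))) (fourth-powers x y x⁴≅y⁴ k))))
  -- Odd powers cancel within ±y and within ±u. The squares collect into y² + u², which vanishes
  -- modulo m.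
  cancel : ∀ p q r s y u w →
    (p + q * y + r * (y * y) + s * (y * (y * y))) * w + (p + q * - y + r * (- y * - y) + s * (- y * (- y * - y))) * w +
    ((p + q * u + r * (u * u) + s * (u * (u * u))) * w + (p + q * - u + r * (- u * - u) + s * (- u * (- u * - u))) * w) ≡
    + 4 * (p * w) + + 2 * r * w * (y * y + u * u)
  cancel = solve-∀
  drop : ∀ x z y → x + z * (y * y + - (y * y)) ≡ x
  drop = solve-∀
  collect : ∀ k → B y k + B (- y) k + (B u k + B (- u) k) ≅ + 4 * binomialTerm h y (k ℕ.* 4) [ m ]
  collect k = ≅-trans (≡⇒≅ (cancel (b 0 k) (b 1 k) (b 2 k) (b 3 k) y u w))
    (≅-trans (+-cong (≅-refl {x = + 4 * (b 0 k * w)}) (*-congˡ (+ 2 * b 2 k * w) (+-cong (≅-refl {x = y * y}) u²≅-y²)))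
      (≡⇒≅ (drop (+ 4 * (b 0 k * w)) (+ 2 * b 2 k * w) y)))
    where
    w : ℤ
    w = y ^ (k ℕ.* 4)

S-≅ : ∀ {h} → OddPrime h → ∀ a →
  S (odd h) a ≅ sumTo (odd h ℕ./ 8) (λ k → binomialTerm h (- (+ 4 * a)) (k ℕ.* 4)) [ odd h ]
S-≅ {h} P a = sumTo-cong-≅ (odd h ℕ./ 8) term
  where
  double : ∀ k → 8 ℕ.* k ≡ k ℕ.* 4 ℕ.+ k ℕ.* 4
  double = ℕRing.solve-∀
  in-range : ∀ k → k ℕ.≤ odd h ℕ./ 8 → k ℕ.* 4 ℕ.≤ h
  in-range k k≤ = ℕP.≮⇒≥ (λ h<4k → ℕP.<⇒≱ (ℕP.n<1+n (odd h)) (begin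
    suc (odd h)            ≡⟨ cong suc (ℕP.+-suc h h) ⟨
    suc h ℕ.+ suc h        ≤⟨ ℕP.+-mono-≤ h<4k h<4k ⟩
    k ℕ.* 4 ℕ.+ k ℕ.* 4    ≡⟨ double k ⟨
    8 ℕ.* k                ≡⟨ ℕP.*-comm 8 k ⟩
    k ℕ.* 8                ≤⟨ ℕP.*-monoˡ-≤ 8 k≤ ⟩
    odd h ℕ./ 8 ℕ.* 8      ≤⟨ ℕDM.m/n*n≤m (odd h) 8 ⟩
    odd h                  ∎))
    where open ℕP.≤-Reasoning
  regroup : ∀ w b v → w * b * v ≡ b * (w * v)
  regroup = solve-∀
  term : ∀ k → k ℕ.≤ odd h ℕ./ 8 →
    binom (8 ℕ.* k) (4 ℕ.* k) * a ^ (4 ℕ.* k) ≅ binomialTerm h (- (+ 4 * a)) (k ℕ.* 4) [ odd h ]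
  term k k≤ = begin
    binom (8 ℕ.* k) (4 ℕ.* k) * a ^ (4 ℕ.* k) ≡⟨ cong₂ (λ m n → binom m n * a ^ n) (double k) (ℕP.*-comm 4 k) ⟩
    binom (n ℕ.+ n) n * a ^ n                 ≈⟨ *-congʳ (a ^ n) (central-≅ P n (in-range k k≤)) ⟩
    (- + 4) ^ n * binom h n * a ^ n           ≡⟨ regroup ((- + 4) ^ n) (binom h n) (a ^ n) ⟩
    binom h n * ((- + 4) ^ n * a ^ n)         ≡⟨ cong (binom h n *_) (*-^-distrib (- + 4) a n) ⟨
    binom h n * (- + 4 * a) ^ n               ≡⟨ cong (λ z → binom h n * z ^ n) (ℤP.neg-distribˡ-* (+ 4) a) ⟨
    binom h n * (- (+ 4 * a)) ^ n             ∎
    where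
    open SetoidReasoning (≅-setoid (odd h))
    n : ℕ
    n = k ℕ.* 4

-- With K = [p/8], 2h + 1 < 8(K + 1) gives h ≤ 4K + 3. The sum thus reaches every exponent divisible
-- by 4 up to h.
half≤ : ∀ h → h ℕ.≤ 3 ℕ.+ odd h ℕ./ 8 ℕ.* 4
half≤ h = ℕP.≮⇒≥ (λ N<h → ℕP.<⇒≱ (ℕDM.m%n<n (odd h) 8) (ℕP.+-cancelʳ-≤ (K ℕ.* 8) 8 _ (begin
    8 ℕ.+ K ℕ.* 8                                  ≡⟨ double K ⟩
    (4 ℕ.+ K ℕ.* 4) ℕ.+ (4 ℕ.+ K ℕ.* 4)            ≤⟨ ℕP.+-mono-≤ N<h N<h ⟩
    h ℕ.+ h                                        ≤⟨ ℕP.n≤1+n (h ℕ.+ h) ⟩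
    odd h                                          ≡⟨ ℕDM.m≡m%n+[m/n]*n (odd h) 8 ⟩
    odd h ℕ.% 8 ℕ.+ K ℕ.* 8                        ∎)))
  where
  open ℕP.≤-Reasoning
  K : ℕ
  K = odd h ℕ./ 8
  double : ∀ K → 8 ℕ.+ K ℕ.* 8 ≡ (4 ℕ.+ K ℕ.* 4) ℕ.+ (4 ℕ.+ K ℕ.* 4)
  double = ℕRing.solve-∀

inverse : ∀ {h} → OddPrime h → ∀ c → ¬ c ≅ 0ℤ [ odd h ] → ∃ λ v → c * v ≅ 1ℤ [ odd h ]
inverse {zero} P _ _ = contradiction (prime-odd⇒half>0 P) (λ ())
-- By Fermat the inverse of c is c^(p-2), written as a product of two powers.
inverse {suc h} P c c≇0 = c ^ h * c ^ suc h , ≅-trans (≡⇒≅ (sym (ℤP.*-assoc c (c ^ h) (c ^ suc h)))) (fermat P c c≇0)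

trit-*≡-1⇒≡ : ∀ {x y} → Trit x → Trit y → x * y ≡ -1ℤ → x + y ≡ 0ℤ
trit-*≡-1⇒≡ (inj₁ refl) _ ()
trit-*≡-1⇒≡ {x} (inj₂ _) (inj₁ refl) e = contradiction (trans (sym (ℤP.*-zeroʳ x)) e) (λ ())
trit-*≡-1⇒≡ (inj₂ (inj₁ refl)) (inj₂ (inj₂ refl)) _ = refl
trit-*≡-1⇒≡ (inj₂ (inj₂ refl)) (inj₂ (inj₁ refl)) _ = refl
trit-*≡-1⇒≡ (inj₂ (inj₁ refl)) (inj₂ (inj₁ refl)) ()
trit-*≡-1⇒≡ (inj₂ (inj₂ refl)) (inj₂ (inj₂ refl)) ()

-- The four symbols

module _ (t : ℕ) (P : OddPrime (t ℕ.+ t)) (c d : ℤ) (p≡ : + odd (t ℕ.+ t) ≡ c * c + d * d) (2∣d : (+ 2) ∣ d) where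

  open TwoSquares t P c d p≡ 2∣d using (legendre≡jacobi)

  private
    h p : ℕ
    h = t ℕ.+ t
    p = odd h

  d²≅-c² : d * d ≅ - (c * c) [ p ]
  d²≅-c² = ≅-witness {y = - (c * c)} 1ℤ (trans (lemma c d) (cong (λ z → - (c * c) + 1ℤ * z) (sym p≡)))
    where
    lemma : ∀ c d → d * d ≡ - (c * c) + 1ℤ * (c * c + d * d)
    lemma = solve-∀

  c≇0 : ¬ c ≅ 0ℤ [ p ]
  c≇0 c≅0 = coprime (isPrime P) c d p≡ (isPrime P) c≅0
    (Sum.[ (λ z → z) , (λ z → z) ]′ (*≅0 (isPrime P) d d (≅-trans d²≅-c² (-‿cong (*-cong c≅0 c≅0)))))

  sqrt-1 : ∃ λ i → c * i ≅ d [ p ] × i * i ≅ -1ℤ [ p ]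
  sqrt-1 = let v , cv≅1 = inverse P c c≇0 in
      d * v
    , ≅-trans (≡⇒≅ (swap c d v)) (≅-trans (*-congˡ d cv≅1) (≡⇒≅ (ℤP.*-identityʳ d)))
    , ≅-trans (≡⇒≅ (regroup d v)) (≅-trans (*-congʳ (v * v) d²≅-c²)
        (≅-trans (≡⇒≅ (regroup′ c v)) (-‿cong (*-cong cv≅1 cv≅1))))
    where
    swap : ∀ c d v → c * (d * v) ≡ d * (c * v)
    swap = solve-∀
    regroup : ∀ d v → d * v * (d * v) ≡ d * d * (v * v)
    regroup = solve-∀
    regroup′ : ∀ c v → - (c * c) * (v * v) ≡ - (c * v * (c * v))
    regroup′ = solve-∀

  legendre-c : legendre c p ≡ 1ℤ
  -- At a = 0 the modulus 16a² + 1 computes to 1, and the Jacobi symbol over 1 is 1 by definition.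
  legendre-c = trans (cong (λ x → legendre x p) (simplify c d)) (legendre≡jacobi 0ℤ)
    where
    simplify : ∀ c d → c ≡ c - + 4 * 0ℤ * d
    simplify = solve-∀

  -- Here s is the symbol of 1 - iy. It stays existential because only its product with the symbol
  -- of 1 + iy enters the result.
  four-legendre : ∀ a → ∃ λ s →
    Trit s × jacobi (c - + 4 * a * d) ∣ + 16 * a * a + 1ℤ ∣ * s ≡ legendre (1ℤ + + 16 * a * a) p ×
    + 2 * (+ 2 * S p a) ≅
      legendre (1ℤ - + 4 * a) p + legendre (1ℤ + + 4 * a) p +
      (jacobi (c - + 4 * a * d) ∣ + 16 * a * a + 1ℤ ∣ + s) [ p ]
  four-legendre a =
      legendre (1ℤ + - u) p
    , legendre-trit (1ℤ + - u) p
    , trans (cong (_* legendre (1ℤ + - u) p) (sym r₂≡)) (trans (sym (legendre-* P (1ℤ + u) (1ℤ + - u)))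
        (legendre-cong P (≅-trans (≡⇒≅ (norm u)) (≅-trans (+-cong (≅-refl {x = 1ℤ}) (-‿cong u²≅-y²)) (≡⇒≅ (norm′ a))))))
    , total
    where
    i y u r₂ : ℤ
    i = proj₁ sqrt-1
    y = - (+ 4 * a)
    u = i * y
    r₂ = jacobi (c - + 4 * a * d) ∣ + 16 * a * a + 1ℤ ∣
    norm : ∀ u → (1ℤ + u) * (1ℤ + - u) ≡ 1ℤ + - (u * u)
    norm = solve-∀
    norm′ : ∀ a → 1ℤ + - - (- (+ 4 * a) * - (+ 4 * a)) ≡ 1ℤ + + 16 * a * a
    norm′ = solve-∀
    square : ∀ i y → i * y * (i * y) ≡ i * i * (y * y)
    square = solve-∀
    neg-one : ∀ z → -1ℤ * z ≡ - z
    neg-one = solve-∀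
    u²≅-y² : u * u ≅ - (y * y) [ p ]
    u²≅-y² = ≅-trans (≡⇒≅ (square i y))
      (≅-trans (*-congʳ (y * y) (proj₂ (proj₂ sqrt-1))) (≡⇒≅ (neg-one (y * y))))
    distribute : ∀ c i a → c * (1ℤ + i * - (+ 4 * a)) ≡ c + - (+ 4 * a) * (c * i)
    distribute = solve-∀
    regroup : ∀ c a d → c + - (+ 4 * a) * d ≡ c - + 4 * a * d
    regroup = solve-∀
    c[1+u]≅ : c * (1ℤ + u) ≅ c - + 4 * a * d [ p ]
    c[1+u]≅ = ≅-trans (≡⇒≅ (distribute c i a))
      (≅-trans (+-cong (≅-refl {x = c}) (*-congˡ (- (+ 4 * a)) (proj₁ (proj₂ sqrt-1)))) (≡⇒≅ (regroup c a d)))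
    -- Multiplying by the symbol of c, which is 1, clears the denominator in 1 + iy.
    r₂≡ : legendre (1ℤ + u) p ≡ r₂
    r₂≡ = begin
      legendre (1ℤ + u) p                ≡⟨ ℤP.*-identityˡ _ ⟨
      1ℤ * legendre (1ℤ + u) p           ≡⟨ cong (_* legendre (1ℤ + u) p) legendre-c ⟨
      legendre c p * legendre (1ℤ + u) p ≡⟨ legendre-* P c (1ℤ + u) ⟨
      legendre (c * (1ℤ + u)) p          ≡⟨ legendre-cong P c[1+u]≅ ⟩
      legendre (c - + 4 * a * d) p       ≡⟨ legendre≡jacobi a ⟩
      r₂                                 ∎
      where open ≡-Reasoning
    K : ℕ
    K = p ℕ./ 8
    double : ∀ x → + 2 * (+ 2 * x) ≡ + 4 * x
    double = solve-∀
    total : + 2 * (+ 2 * S p a) ≅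
      legendre (1ℤ - + 4 * a) p + legendre (1ℤ + + 4 * a) p + (r₂ + legendre (1ℤ + - u) p) [ p ]
    total = begin
      + 2 * (+ 2 * S p a)                                         ≡⟨ double (S p a) ⟩
      + 4 * S p a                                                 ≈⟨ *-congˡ (+ 4) (S-≅ P a) ⟩
      + 4 * sumTo K (λ k → binomialTerm h y (k ℕ.* 4))            ≈⟨ quadrisection h K y u (half≤ h) u²≅-y² ⟨
      (1ℤ + y) ^ h + (1ℤ + - y) ^ h + ((1ℤ + u) ^ h + (1ℤ + - u) ^ h)
        ≈⟨ +-cong (+-cong (euler P (1ℤ + y)) (euler P (1ℤ + - y))) (+-cong (euler P (1ℤ + u)) (euler P (1ℤ + - u))) ⟨
      legendre (1ℤ + y) p + legendre (1ℤ + - y) p + (legendre (1ℤ + u) p + legendre (1ℤ + - u) p)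
        ≡⟨ cong₂ (λ v w → legendre (1ℤ + y) p + v + (w + legendre (1ℤ + - u) p))
             (cong (λ z → legendre (1ℤ + z) p) (ℤP.neg-involutive (+ 4 * a))) r₂≡ ⟩
      legendre (1ℤ - + 4 * a) p + legendre (1ℤ + + 4 * a) p + (r₂ + legendre (1ℤ + - u) p) ∎
      where open SetoidReasoning (≅-setoid p)

  legendre-1-16a² : ∀ a → legendre (1ℤ - + 4 * a) p * legendre (1ℤ + + 4 * a) p ≡ legendre (1ℤ - + 16 * a * a) p
  legendre-1-16a² a = trans (sym (legendre-* P (1ℤ - + 4 * a) (1ℤ + + 4 * a))) (cong (λ x → legendre x p) (factor a))
    where
    factor : ∀ a → (1ℤ - + 4 * a) * (1ℤ + + 4 * a) ≡ 1ℤ - + 16 * a * a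
    factor = solve-∀

  jacobi-trit : ∀ a → Trit (jacobi (c - + 4 * a * d) ∣ + 16 * a * a + 1ℤ ∣)
  jacobi-trit a = subst Trit (legendre≡jacobi a) (legendre-trit (c - + 4 * a * d) p)

-- The four cases of the theorem

1mod4⇒isPrime1mod4 : ∀ {p} → Prime p → p ℕ.% 4 ≡ 1 → IsPrime1mod4 p
1mod4⇒isPrime1mod4 {p} pp p%4≡1 = subst IsPrime1mod4 (sym p≡) (isPrime1mod4 (p ℕ./ 4) (oddPrime (subst Prime p≡ pp)))
  where
  quadruple : ∀ t → 1 ℕ.+ t ℕ.* 4 ≡ suc (t ℕ.+ t ℕ.+ (t ℕ.+ t))
  quadruple = ℕRing.solve-∀
  p≡ : p ≡ odd (p ℕ./ 4 ℕ.+ p ℕ./ 4)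
  p≡ = trans (ℕDM.m≡m%n+[m/n]*n p 4) (trans (cong (ℕ._+ p ℕ./ 4 ℕ.* 4) p%4≡1) (quadruple (p ℕ./ 4)))

2*-cancel : ∀ {p} → IsPrime1mod4 p → ∀ x y → + 2 * x ≅ + 2 * y [ p ] → x ≅ y [ p ]
2*-cancel (isPrime1mod4 j P) x y = *-cancelˡ (isPrime P) (+ 2) (2≇0 P)

module _ {p : ℕ} (P : IsPrime1mod4 p) (c d : ℤ) (p≡ : + p ≡ c * c + d * d) (2∣d : (+ 2) ∣ d) (a : ℤ) where

  private
    L r₁ r₂ ε₁ ε₂ : ℤ
    L = + 2 * S p a
    r₁ = legendre (1ℤ - + 4 * a) p
    r₂ = jacobi (c - + 4 * a * d) ∣ + 16 * a * a + 1ℤ ∣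
    ε₁ = legendre (1ℤ - + 16 * a * a) p
    ε₂ = legendre (1ℤ + + 16 * a * a) p

    -- What the product ε of two symbols, one of them r, says about their sum s.
    PairSum : ℤ → ℤ → ℤ → Set
    PairSum r ε s = (ε ≡ 1ℤ → s ≡ r + r) × (ε ≡ -1ℤ → s ≡ 0ℤ)

    pairSum : ∀ {r s ε} → Trit r → Trit s → r * s ≡ ε → PairSum r ε (r + s)
    pairSum {r} r-trit s-trit refl =
        (λ e → cong (λ z → r + z) (sym (trit-*≡1⇒≡ r-trit s-trit e)))
      , (λ e → trit-*≡-1⇒≡ r-trit s-trit e)

  pair-sums : ∃ λ s₁ → ∃ λ s₂ → PairSum r₁ ε₁ s₁ × PairSum r₂ ε₂ s₂ × + 2 * L ≅ s₁ + s₂ [ p ]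
  pair-sums = go P p≡
    where
    -- Module parameters cannot be matched on, so p and its witness are generalised again.
    go : ∀ {p} → IsPrime1mod4 p → + p ≡ c * c + d * d →
      ∃ λ s₁ → ∃ λ s₂ → PairSum (legendre (1ℤ - + 4 * a) p) (legendre (1ℤ - + 16 * a * a) p) s₁ ×
        PairSum r₂ (legendre (1ℤ + + 16 * a * a) p) s₂ × + 2 * (+ 2 * S p a) ≅ s₁ + s₂ [ p ]
    go (isPrime1mod4 t P) p≡ = let s , s-trit , r₂s≡ , total = four-legendre t P c d p≡ 2∣d a in
        _ , _
      , pairSum (legendre-trit (1ℤ - + 4 * a) (odd (t ℕ.+ t))) (legendre-trit (1ℤ + + 4 * a) (odd (t ℕ.+ t)))
          (legendre-1-16a² t P c d p≡ 2∣d a)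
      , pairSum (jacobi-trit t P c d p≡ 2∣d a) s-trit r₂s≡
      , total

  congruence-from-pairs : ∀ {x y z} → (∀ {s₁} → PairSum r₁ ε₁ s₁ → s₁ ≡ x) → (∀ {s₂} → PairSum r₂ ε₂ s₂ → s₂ ≡ y) →
    x + y ≡ + 2 * z → L ≅ z [ p ]
  congruence-from-pairs {z = z} s₁≡ s₂≡ x+y≡ = let s₁ , s₂ , P₁ , P₂ , total = pair-sums in
    2*-cancel P L z (≅-trans total (≡⇒≅ (trans (cong₂ _+_ (s₁≡ P₁) (s₂≡ P₂)) x+y≡)))

theorem2p12 : (p : ℕ) → Prime p → p ℕ.% 4 ≡ 1 →
    (c d : ℤ) → + p ≡ c * c + d * d → (+ 2) ∣ d →
    (a : ℤ) → ¬ ((+ p) ∣ ((1ℤ + + 16 * a * a) * (1ℤ - + 16 * a * a))) →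
    let L = + 2 * S p a
        m = ∣ + 16 * a * a + 1ℤ ∣
        r₁ = legendre (1ℤ - + 4 * a) p
        r₂ = jacobi (c - + 4 * a * d) m
    in ((legendre (1ℤ - + 16 * a * a) p ≡ 1ℤ × legendre (1ℤ + + 16 * a * a) p ≡ 1ℤ)
          → (+ p) ∣ (L - (r₁ + r₂)))
     × ((legendre (1ℤ - + 16 * a * a) p ≡ 1ℤ × legendre (1ℤ + + 16 * a * a) p ≡ - 1ℤ)
          → (+ p) ∣ (L - r₁))
     × ((legendre (1ℤ - + 16 * a * a) p ≡ - 1ℤ × legendre (1ℤ + + 16 * a * a) p ≡ 1ℤ)
          → (+ p) ∣ (L - r₂))
     × ((legendre (1ℤ - + 16 * a * a) p ≡ - 1ℤ × legendre (1ℤ + + 16 * a * a) p ≡ - 1ℤ)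
          → (+ p) ∣ L)
theorem2p12 p pp p%4≡1 c d p≡ 2∣d a _ =
    -- Each pair contributes twice its known symbol or nothing. Halving the total gives the claimed
    -- residue.
    (λ (e₁ , e₂) → ≅⇒∣ (from-pairs (λ P₁ → proj₁ P₁ e₁) (λ P₂ → proj₁ P₂ e₂) (both r₁ r₂)))
  , (λ (e₁ , e₂) → ≅⇒∣ (from-pairs (λ P₁ → proj₁ P₁ e₁) (λ P₂ → proj₂ P₂ e₂) (left r₁)))
  , (λ (e₁ , e₂) → ≅⇒∣ (from-pairs (λ P₁ → proj₂ P₁ e₁) (λ P₂ → proj₁ P₂ e₂) (right r₂)))
  , (λ (e₁ , e₂) → ≅0⇒∣ (from-pairs (λ P₁ → proj₂ P₁ e₁) (λ P₂ → proj₂ P₂ e₂) refl))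
  where
  r₁ r₂ : ℤ
  r₁ = legendre (1ℤ - + 4 * a) p
  r₂ = jacobi (c - + 4 * a * d) ∣ + 16 * a * a + 1ℤ ∣
  from-pairs = λ {x} {y} {z} → congruence-from-pairs (1mod4⇒isPrime1mod4 pp p%4≡1) c d p≡ 2∣d a {x} {y} {z}
  both : ∀ r s → r + r + (s + s) ≡ + 2 * (r + s)
  both = solve-∀
  left : ∀ r → r + r + 0ℤ ≡ + 2 * r
  left = solve-∀
  right : ∀ r → 0ℤ + (r + r) ≡ + 2 * r
  right = solve-∀
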